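{- Let $n,m,l$ be positive integers with $m<\frac{n}{2}$ and $l\geq n+1$, and let ${\bf A}_n^{(m,l)}$ be the analogous Craig lattice defined in the context. (1) If $n+1$ is a prime or $m=1$, then ${\bf A}_n^{(m,n+1)}$ equals the Craig lattice ${\bf A}_n^{(m)}$. (2) ${\bf A}_n^{(m,l)}$ is a lattice of rank $n$ with volume $l^{m-1}(n+1)^{1/2}$. Moreover, if $l$ is a prime number, then the minimum norm satisfies $\mu({\bf A}_n^{(m,l)})\geq 2m$.
   Context: Let $R={\bf Z}\langle 1,x,\dots,x^n\rangle$ be the free ${\bf Z}$-module of integer polynomials of degree at most $n$; identify $a_0+a_1x+\cdots+a_nx^n$ with $(a_0,\dots,a_n)\in{\bf Z}^{n+1}\subset{\bf R}^{n+1}$ (so $1,x,\dots,x^n$ is an orthonormal basis). The analogous Craig lattice is the ${\bf Z}$-submodule ${\bf A}_n^{(m,l)}={\bf Z}(x-1)^n+{\bf Z}(x-1)^{n-1}+\cdots+{\bf Z}(x-1)^m+l{\bf Z}(x-1)^{m-1}+l{\bf Z}(x-1)^{m-2}+\cdots+l{\bf Z}(x-1)$, viewed as a lattice in ${\bf R}^{n+1}$. The Craig lattice ${\bf A}_n^{(m)}$ is the ideal generated by $(x-1)^m$ in ${\bf Z}[x]/(x^{n+1}-1)$, viewed in ${\bf Z}^{n+1}$ via coefficient vectors of representatives of degree at most $n$. For a lattice ${\bf L}$ with basis ${\bf b}_1,\dots,{\bf b}_r$, its volume is $\det(\langle{\bf b}_i,{\bf b}_j\rangle)^{1/2}$, and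 its minimum norm $\mu({\bf L})$ is the squared Euclidean length of a shortest nonzero vector. -}

module Defs where

open import Data.Nat as ℕ using (ℕ; zero; suc; _<ᵇ_)
open import Data.Nat.DivMod using (_mod_)
open import Data.Integer as ℤ using (ℤ; +_; -_; _+_; _-_; _*_)
open import Data.Fin using (Fin; zero; suc; toℕ; punchIn)
open import Data.Bool using (if_then_else_)
open import Data.Product using (Σ; _×_)
open import Relation.Binary.PropositionalEquality using (_≡_)

Vecℤ : ℕ → Set
Vecℤ d = Fin d → ℤ

sumFin : (d : ℕ) → (Fin d → ℤ) → ℤ
sumFin zero    f = + 0
sumFin (suc d) f = f zero + sumFin d (λ i → f (suc i))

-- Standard inner product (1, x, ..., x^n orthonormal) and squared norm.
⟨_,_⟩ : {d : ℕ} → Vecℤ d → Vecℤ d → ℤ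
⟨_,_⟩ {d} u v = sumFin d (λ i → u i * v i)

normSq : {d : ℕ} → Vecℤ d → ℤ
normSq v = ⟨ v , v ⟩

sign : ℕ → ℤ
sign zero          = + 1
sign (suc zero)    = - (+ 1)
sign (suc (suc k)) = sign k

det : (r : ℕ) → (Fin r → Fin r → ℤ) → ℤ
det zero    M = + 1
det (suc r) M =
  sumFin (suc r) (λ j → sign (toℕ j) * M zero j * det r (λ a b → M (suc a) (punchIn j b)))

-- Coefficients of (x-1)^k : powXm1 k i = coefficient of x^i,
-- defined by repeated multiplication by (x - 1).
powXm1 : ℕ → ℕ → ℤ
powXm1 zero    zero    = + 1
powXm1 zero    (suc i) = + 0
powXm1 (suc k) zero    = - powXm1 k zero
powXm1 (suc k) (suc i) = powXm1 k i - powXm1 k (suc i)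

xm1^ : (n k : ℕ) → Vecℤ (suc n)
xm1^ n k i = powXm1 k (toℕ i)

gen : (n m l : ℕ) → Fin n → Vecℤ (suc n)
gen n m l j i =
  (if suc (toℕ j) <ᵇ m then + l else + 1) * xm1^ n (suc (toℕ j)) i

comb : (n m l : ℕ) → (Fin n → ℤ) → Vecℤ (suc n)
comb n m l c i = sumFin n (λ j → c j * gen n m l j i)

_∈A[_,_,_] : {n : ℕ} → Vecℤ (suc n) → ℕ → ℕ → ℕ → Set
_∈A[_,_,_] {n} v _ m l = Σ (Fin n → ℤ) (λ c → ∀ i → v i ≡ comb n m l c i)

-- Multiplication in ℤ[x]/(x^{n+1} - 1), elements represented by their
-- coefficient vectors of degree ≤ n (cyclic convolution).
cyc* : {n : ℕ} → Vecℤ (suc n) → Vecℤ (suc n) → Vecℤ (suc n)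
cyc* {n} f g i = sumFin (suc n) (λ j → f j * g ((toℕ i ℕ.+ suc n ℕ.∸ toℕ j) mod suc n))

_∈Craig[_,_] : {n : ℕ} → Vecℤ (suc n) → ℕ → ℕ → Set
_∈Craig[_,_] {n} v _ m = Σ (Vecℤ (suc n)) (λ f → ∀ i → v i ≡ cyc* f (xm1^ n m) i)

gram : (n m l : ℕ) → Fin n → Fin n → ℤ
gram n m l a b = ⟨ gen n m l a , gen n m l b ⟩

{-# OPTIONS --safe #-}
-- Determinant. Since (x − 1)ᵃ⁺¹ = Σ_b p_{ab} (xᵇ⁺¹ − xᵇ), where p_{ab} is the coefficient of xᵇ in
-- (x − 1)ᵃ, the Gram matrix is L K Lᵀ with L lower triangular with diagonal (l, …, l, 1, …, 1) and
-- K the Cartan matrix of Aₙ, whose determinant is n + 1.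
--
-- Minimum norm. Pairing a lattice vector v with the function iᵏ gives finite differences of iᵏ, so
-- Σ vᵢ iᵏ ≡ 0 mod l for k < m, and Σ vᵢ = 0. Write v as the difference of two disjoint multisets of
-- indices; they have the same size N, with 2N ≤ |v|². If N < m, then Newton's identities, in which
-- one divides by k ≤ N < l only, make the elementary symmetric functions of both multisets congruent
-- mod l. Hence both have the same residues mod l, and as l > n they share an index: a contradiction.
--
-- Craig lattices. With Y the multiplication by x − 1, (1 + Y)ⁿ⁺¹ = 1 modulo xⁿ⁺¹ − 1. If n + 1 is
-- prime, it divides the inner binomial coefficients, so this relation shows that A is closed under Y,
-- and, by downward induction on j ≤ m, that (n + 1)(x − 1)ʲ lies in the ideal generated by (x − 1)ᵐ.
module Submission where

open import Defs
open import Algebra.Bundles using (module AbelianGroup)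
open import Algebra.Properties.Group using (∙-cancelˡ)
open import Data.Bool.Base using (if_then_else_; true; false; T)
open import Data.Empty using (⊥; ⊥-elim)
open import Data.Fin.Base as Fin using (Fin; zero; suc; toℕ; fromℕ; fromℕ<; inject₁; punchIn)
import Data.Fin.Properties as Fin
open import Data.Integer.Base as ℤ using (ℤ; +_; -[1+_]; -_; _+_; _-_) renaming (∣_∣ to abs)
open import Data.Integer.Divisibility.Signed
open import Data.Integer.Properties
open import Data.Integer.Tactic.RingSolver using (solve-∀)
open import Data.List.Base using (List; []; _∷_; length; map; _++_; replicate)
open import Data.List.Membership.Propositional using (_∈_)
open import Data.List.Membership.Propositional.Properties using (∈-map⁺; ∈-map⁻)
open import Data.List.Properties using (length-map)
open import Data.List.Relation.Unary.All as All using (All; [])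
import Data.List.Relation.Unary.All.Properties as All
open import Data.List.Relation.Unary.Any using (here; there)
open import Data.Nat.Base as ℕ using (ℕ; zero; suc; z≤n; s≤s; _<ᵇ_)
import Data.Nat.Divisibility as ℕ
open import Data.Nat.DivMod using (_mod_; _%_; [m+n]%n≡m%n; m<n⇒m%n≡m; m%n<n)
open import Data.Nat.Primality using (Prime; euclidsLemma; ¬prime[1])
import Data.Nat.Properties as ℕ
import Data.Nat.Tactic.RingSolver as ℕ-Solver
open import Data.Product.Base using (∃; _×_; _,_; proj₂)
open import Data.Sum.Base as Sum using (_⊎_; inj₁; inj₂)
open import Data.Unit.Base using (tt)
open import Function.Base using (id)
open import Relation.Binary.PropositionalEquality
open import Relation.Nullary using (yes; no; does)

-- Finite sums of integers.

module Sums where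

  open import Data.Integer.Base using (_*_)

  -- An opaque copy of sumFin: sumFin (suc d) f unfolds, and f cannot then be inferred.
  opaque
    ∑ : ∀ d → (Fin d → ℤ) → ℤ
    ∑ = sumFin

    ∑-sumFin : ∀ d f → ∑ d f ≡ sumFin d f
    ∑-sumFin d f = refl

    ∑-zero : ∀ f → ∑ 0 f ≡ + 0
    ∑-zero f = refl

    ∑-suc : ∀ d f → ∑ (suc d) f ≡ f zero + ∑ d (λ i → f (suc i))
    ∑-suc d f = refl

    ∑-cong : ∀ d {f g : Fin d → ℤ} → (∀ i → f i ≡ g i) → ∑ d f ≡ ∑ d g
    ∑-cong zero    f≗g = refl
    ∑-cong (suc d) f≗g = cong₂ _+_ (f≗g zero) (∑-cong d (λ i → f≗g (suc i)))

    ∑-0 : ∀ d {f : Fin d → ℤ} → (∀ i → f i ≡ + 0) → ∑ d f ≡ + 0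
    ∑-0 zero    f≗0 = refl
    ∑-0 (suc d) f≗0 = cong₂ _+_ (f≗0 zero) (∑-0 d (λ i → f≗0 (suc i)))

    ∑-+ : ∀ d (f g : Fin d → ℤ) → ∑ d (λ i → f i + g i) ≡ ∑ d f + ∑ d g
    ∑-+ zero    f g = refl
    ∑-+ (suc d) f g = trans
      (cong (λ z → f zero + g zero + z) (∑-+ d (λ i → f (suc i)) (λ i → g (suc i))))
      (interchange (f zero) (g zero) (sumFin d (λ i → f (suc i))) (sumFin d (λ i → g (suc i))))
      where
      interchange : ∀ a b c d → (a + b) + (c + d) ≡ (a + c) + (b + d)
      interchange = solve-∀

    ∑-*ˡ : ∀ d c (f : Fin d → ℤ) → ∑ d (λ i → c * f i) ≡ c * ∑ d f
    ∑-*ˡ zero    c f = sym (*-zeroʳ c)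
    ∑-*ˡ (suc d) c f = trans
      (cong (λ z → c * f zero + z) (∑-*ˡ d c (λ i → f (suc i)))) (sym (*-distribˡ-+ c (f zero) _))

    ∑-*ʳ : ∀ d c (f : Fin d → ℤ) → ∑ d (λ i → f i * c) ≡ ∑ d f * c
    ∑-*ʳ d c f = trans (∑-cong d (λ i → *-comm (f i) c)) (trans (∑-*ˡ d c f) (*-comm c _))

    ∑-swap : ∀ d e (f : Fin d → Fin e → ℤ) → ∑ d (λ i → ∑ e (f i)) ≡ ∑ e (λ j → ∑ d (λ i → f i j))
    ∑-swap zero    e f = sym (∑-0 e (λ _ → refl))
    ∑-swap (suc d) e f = trans
      (cong (λ z → sumFin e (f zero) + z) (∑-swap d e (λ i → f (suc i)))) (sym (∑-+ e (f zero) _))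

    -- The summand is a function on ℕ, so that splitting off the last index needs no `inject₁`.
    ∑-snoc : ∀ d (f : ℕ → ℤ) → ∑ (suc d) (λ i → f (toℕ i)) ≡ ∑ d (λ i → f (toℕ i)) + f d
    ∑-snoc zero    f = +-comm (f 0) (+ 0)
    ∑-snoc (suc d) f = trans (cong (λ z → f 0 + z) (∑-snoc d (λ i → f (suc i)))) (sym (+-assoc (f 0) _ _))

  ∑-- : ∀ d (f g : Fin d → ℤ) → ∑ d (λ i → f i - g i) ≡ ∑ d f - ∑ d g
  ∑-- d f g = trans (∑-+ d f (λ i → - g i)) (cong (λ z → ∑ d f + z) (trans
    (∑-cong d (λ i → sym (-1*i≡-i (g i)))) (trans (∑-*ˡ d (- (+ 1)) g) (-1*i≡-i (∑ d g)))))

-- Determinants: transposition, row operations, products with a triangular matrix.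

module Determinants where

  open import Data.Integer.Base using (_*_)
  open Sums

  Matrix : ℕ → Set
  Matrix r = Fin r → Fin r → ℤ

  minor : ∀ {r} → Matrix (suc r) → Fin (suc r) → Matrix r
  minor M j a b = M (suc a) (punchIn j b)

  opaque
    unfolding ∑

    -- Opaque for the same reason as `∑`: `det (suc r) M` would unfold and M could not be inferred
    -- from it.
    Det : ∀ r → Matrix r → ℤ
    Det = det

    Det-det : ∀ r M → Det r M ≡ det r M
    Det-det r M = refl

    Det-zero : ∀ M → Det 0 M ≡ + 1
    Det-zero M = refl

    Det-suc : ∀ r M → Det (suc r) M ≡ ∑ (suc r) (λ j → sign (toℕ j) * M zero j * Det r (minor M j))
    Det-suc r M = refl

  Det-cong : ∀ r {M N : Matrix r} → (∀ a b → M a b ≡ N a b) → Det r M ≡ Det r N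
  Det-cong zero    {M} {N} M≗N = trans (Det-zero M) (sym (Det-zero N))
  Det-cong (suc r) {M} {N} M≗N = trans (Det-suc r M) (trans
    (∑-cong (suc r) λ j →
      cong₂ _*_ (cong (λ z → sign (toℕ j) * z) (M≗N zero j)) (Det-cong r (λ a b → M≗N (suc a) (punchIn j b))))
    (sym (Det-suc r N)))

  sign-suc : ∀ k → sign (suc k) ≡ - sign k
  sign-suc zero          = refl
  sign-suc (suc zero)    = refl
  sign-suc (suc (suc k)) = sign-suc k

  _ᵀ : ∀ {r} → Matrix r → Matrix r
  (M ᵀ) a b = M b a

  -- Expanding along the first row and then the minors along their first column
  -- gives an expression that is symmetric in rows and columns.
  module TransposeStep (r : ℕ)
    (transpose₁ : ∀ (M : Matrix (suc r)) → Det (suc r) (M ᵀ) ≡ Det (suc r) M)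
    (transpose₀ : ∀ (M : Matrix r) → Det r (M ᵀ) ≡ Det r M)
    where

    term : Matrix (suc (suc r)) → Fin (suc r) → Fin (suc r) → ℤ
    term M j i = sign (suc (toℕ j)) * M zero (suc j) * (sign (toℕ i) * M (suc i) zero *
      Det r (λ a b → M (suc (punchIn i a)) (suc (punchIn j b))))

    expand : ∀ M → Det (suc (suc r)) M ≡
      + 1 * M zero zero * Det (suc r) (minor M zero) + ∑ (suc r) (λ j → ∑ (suc r) (term M j))
    expand M = trans (Det-suc (suc r) M) (trans (∑-suc (suc r) _) (cong
      (λ z → + 1 * M zero zero * Det (suc r) (minor M zero) + z)
      (∑-cong (suc r) λ j → begin
        s j * Det (suc r) (minor M (suc j))
          ≡⟨ cong (λ z → s j * z) (sym (transpose₁ (minor M (suc j)))) ⟩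
        s j * Det (suc r) (minor M (suc j) ᵀ)
          ≡⟨ cong (λ z → s j * z) (Det-suc r _) ⟩
        s j * ∑ (suc r) (λ i → sign (toℕ i) * M (suc i) zero * Det r (minor (minor M (suc j) ᵀ) i))
          ≡⟨ cong (λ z → s j * z) (∑-cong (suc r) λ i →
               cong (λ z → sign (toℕ i) * M (suc i) zero * z) (transpose₀ _)) ⟩
        s j * ∑ (suc r) (λ i → sign (toℕ i) * M (suc i) zero *
          Det r (λ a b → M (suc (punchIn i a)) (suc (punchIn j b))))
          ≡⟨ sym (∑-*ˡ (suc r) (s j) _) ⟩
        ∑ (suc r) (term M j) ∎)))
      where
      open ≡-Reasoning
      s : Fin (suc r) → ℤ
      s j = sign (suc (toℕ j)) * M zero (suc j)

    reorder : ∀ s t x y d → (- s) * x * (t * y * d) ≡ (- t) * y * (s * x * d)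
    reorder = solve-∀

    -- The sign is minus the product of `sign (toℕ j)` and `sign (toℕ i)`, hence symmetric, and
    -- transposition exchanges the entries of the first row and the first column.
    term-swap : ∀ M j i → term (M ᵀ) j i ≡ term M i j
    term-swap M j i rewrite sign-suc (toℕ j) | sign-suc (toℕ i)
      | transpose₀ (λ a b → M (suc (punchIn j a)) (suc (punchIn i b))) =
      reorder (sign (toℕ j)) (sign (toℕ i)) (M (suc j) zero) (M zero (suc i)) _

    transpose₂ : ∀ (M : Matrix (suc (suc r))) → Det (suc (suc r)) (M ᵀ) ≡ Det (suc (suc r)) M
    transpose₂ M = begin
      Det (suc (suc r)) (M ᵀ)
        ≡⟨ expand (M ᵀ) ⟩
      + 1 * M zero zero * Det (suc r) (minor M zero ᵀ) + ∑ (suc r) (λ j → ∑ (suc r) (term (M ᵀ) j))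
        ≡⟨ cong₂ (λ y z → + 1 * M zero zero * y + z) (transpose₁ (minor M zero))
             (trans (∑-cong (suc r) (λ j → ∑-cong (suc r) (term-swap M j))) (∑-swap (suc r) (suc r) _)) ⟩
      + 1 * M zero zero * Det (suc r) (minor M zero) + ∑ (suc r) (λ j → ∑ (suc r) (term M j))
        ≡⟨ sym (expand M) ⟩
      Det (suc (suc r)) M ∎
      where open ≡-Reasoning

  -- The recursion goes back two sizes, because the step expands along a row and then along a
  -- column.
  Det-transpose : ∀ r (M : Matrix r) → Det r (M ᵀ) ≡ Det r M
  Det-transpose zero          M = trans (Det-zero _) (sym (Det-zero M))
  Det-transpose (suc zero)    M = Det-cong 1 λ { zero zero → refl }
  Det-transpose (suc (suc r)) M = TransposeStep.transpose₂ r (Det-transpose (suc r)) (Det-transpose r) M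

  -- Expand along the first row. If i is that row, the entries split and the minors agree; otherwise
  -- the entries agree and the minors split by induction.
  Det-linear : ∀ {r} (i : Fin r) c (M A B : Matrix r) →
    (∀ b → M i b ≡ A i b + c * B i b) →
    (∀ a b → a ≢ i → M a b ≡ A a b) → (∀ a b → a ≢ i → M a b ≡ B a b) →
    Det r M ≡ Det r A + c * Det r B
  Det-linear {suc r} i c M A B M≗A+cB M≗A M≗B = begin
    Det (suc r) M
      ≡⟨ Det-suc r M ⟩
    ∑ (suc r) (term M)
      ≡⟨ ∑-cong (suc r) (term-linear i M≗A+cB M≗A M≗B) ⟩
    ∑ (suc r) (λ j → term A j + c * term B j)
      ≡⟨ ∑-+ (suc r) (term A) (λ j → c * term B j) ⟩
    ∑ (suc r) (term A) + ∑ (suc r) (λ j → c * term B j)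
      ≡⟨ cong₂ _+_ (sym (Det-suc r A))
           (trans (∑-*ˡ (suc r) c (term B)) (cong (λ z → c * z) (sym (Det-suc r B)))) ⟩
    Det (suc r) A + c * Det (suc r) B ∎
    where
    open ≡-Reasoning

    term : Matrix (suc r) → Fin (suc r) → ℤ
    term M j = sign (toℕ j) * M zero j * Det r (minor M j)

    split-entry : ∀ s x y d c → s * (x + c * y) * d ≡ s * x * d + c * (s * y * d)
    split-entry = solve-∀

    split-minor : ∀ s x d e c → s * x * (d + c * e) ≡ s * x * d + c * (s * x * e)
    split-minor = solve-∀

    term-linear : ∀ i → (∀ b → M i b ≡ A i b + c * B i b) →
      (∀ a b → a ≢ i → M a b ≡ A a b) → (∀ a b → a ≢ i → M a b ≡ B a b) →
      ∀ j → term M j ≡ term A j + c * term B j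
    term-linear zero M≗A+cB M≗A M≗B j
      rewrite M≗A+cB j
            | sym (Det-cong r {minor M j} {minor A j} (λ a b → M≗A (suc a) (punchIn j b) λ ()))
            | sym (Det-cong r {minor M j} {minor B j} (λ a b → M≗B (suc a) (punchIn j b) λ ())) =
      split-entry (sign (toℕ j)) (A zero j) (B zero j) (Det r (minor M j)) c
    term-linear (suc i) M≗A+cB M≗A M≗B j
      rewrite sym (M≗A zero j λ ()) | sym (M≗B zero j λ ())
            | Det-linear i c (minor M j) (minor A j) (minor B j)
                (λ b → M≗A+cB (punchIn j b))
                (λ a b a≢i → M≗A (suc a) (punchIn j b) (λ eq → a≢i (Fin.suc-injective eq)))
                (λ a b a≢i → M≗B (suc a) (punchIn j b) (λ eq → a≢i (Fin.suc-injective eq))) =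
      split-minor (sign (toℕ j)) (M zero j) (Det r (minor A j)) (Det r (minor B j)) c

  -- The pairs (j , punchIn j k) run over all ordered pairs of distinct columns;
  -- (inject₁ j , k) and (suc k , j) with j ≤ k are the two orders of one pair.
  ∑-antisym : ∀ d (f : Fin (suc d) → Fin d → ℤ) →
    (∀ j k → j Fin.≤ k → f (inject₁ j) k + f (suc k) j ≡ + 0) →
    ∑ (suc d) (λ j → ∑ d (f j)) ≡ + 0
  ∑-antisym zero    f anti = ∑-0 1 (λ j → ∑-zero (f j))
  ∑-antisym (suc d) f anti = begin
    ∑ (suc (suc d)) (λ j → ∑ (suc d) (f j))
      ≡⟨ ∑-suc (suc d) _ ⟩
    ∑ (suc d) (f zero) + ∑ (suc d) (λ j → ∑ (suc d) (f (suc j)))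
      ≡⟨ cong (λ z → ∑ (suc d) (f zero) + z) (trans (∑-cong (suc d) (λ j → ∑-suc d (f (suc j)))) (∑-+ (suc d) _ _)) ⟩
    ∑ (suc d) (f zero) + (∑ (suc d) (λ j → f (suc j) zero) + ∑ (suc d) (λ j → ∑ d (λ k → f (suc j) (suc k))))
      ≡⟨ sym (+-assoc (∑ (suc d) (f zero)) _ _) ⟩
    ∑ (suc d) (f zero) + ∑ (suc d) (λ j → f (suc j) zero) + ∑ (suc d) (λ j → ∑ d (λ k → f (suc j) (suc k)))
      ≡⟨ cong₂ _+_
           (trans (sym (∑-+ (suc d) _ _)) (∑-0 (suc d) (λ k → anti zero k z≤n)))
           (∑-antisym d (λ j k → f (suc j) (suc k)) (λ j k j≤k → anti (suc j) (suc k) (s≤s j≤k))) ⟩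
    + 0 ∎
    where open ≡-Reasoning

  -- With the next two lemmas: for j ≤ k, removing column `inject₁ j` and then k, or column `suc k`
  -- and then j, removes the same two columns in opposite orders.
  punchIn-inject₁ : ∀ {d} (j k : Fin d) → j Fin.≤ k → punchIn (inject₁ j) k ≡ suc k
  punchIn-inject₁ zero    k       _         = refl
  punchIn-inject₁ (suc j) (suc k) (s≤s j≤k) = cong suc (punchIn-inject₁ j k j≤k)

  punchIn-suc : ∀ {d} (j k : Fin d) → j Fin.≤ k → punchIn (suc k) j ≡ inject₁ j
  punchIn-suc zero    k       _         = refl
  punchIn-suc (suc j) (suc k) (s≤s j≤k) = cong suc (punchIn-suc j k j≤k)

  punchIn-exchange : ∀ {d} (j k : Fin (suc d)) → j Fin.≤ k → (b : Fin d) →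
    punchIn (inject₁ j) (punchIn k b) ≡ punchIn (suc k) (punchIn j b)
  punchIn-exchange zero    k       _         b       = refl
  punchIn-exchange (suc j) (suc k) (s≤s j≤k) zero    = refl
  punchIn-exchange (suc j) (suc k) (s≤s j≤k) (suc b) = cong suc (punchIn-exchange j k j≤k b)

  -- In the expansion along the first two rows, a term of M for an ordered pair of columns cancels
  -- the term of N for the reversed pair. Two matrices related entry by entry make the lemma usable
  -- without function extensionality.
  Det-swap : ∀ r (M N : Matrix (suc (suc r))) →
    (∀ b → M zero b ≡ N (suc zero) b) → (∀ b → M (suc zero) b ≡ N zero b) →
    (∀ a b → M (suc (suc a)) b ≡ N (suc (suc a)) b) →
    Det (suc (suc r)) M + Det (suc (suc r)) N ≡ + 0
  Det-swap r M N M₀≗N₁ M₁≗N₀ M≗N = begin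
    Det (suc (suc r)) M + Det (suc (suc r)) N
      ≡⟨ cong₂ _+_ (expand₂ M) (expand₂ N) ⟩
    ∑ (suc (suc r)) (λ j → ∑ (suc r) (term M j)) + ∑ (suc (suc r)) (λ j → ∑ (suc r) (term N j))
      ≡⟨ sym (∑-+ (suc (suc r)) _ _) ⟩
    ∑ (suc (suc r)) (λ j → ∑ (suc r) (term M j) + ∑ (suc r) (term N j))
      ≡⟨ ∑-cong (suc (suc r)) (λ j → sym (∑-+ (suc r) (term M j) (term N j))) ⟩
    ∑ (suc (suc r)) (λ j → ∑ (suc r) (λ k → term M j k + term N j k))
      ≡⟨ ∑-antisym (suc r) _ antisym ⟩
    + 0 ∎
    where
    open ≡-Reasoning

    minor₂ : Matrix (suc (suc r)) → Fin (suc (suc r)) → Fin (suc r) → Matrix r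
    minor₂ M j k = minor (minor M j) k

    term : Matrix (suc (suc r)) → Fin (suc (suc r)) → Fin (suc r) → ℤ
    term M j k = sign (toℕ j) * M zero j * (sign (toℕ k) * M (suc zero) (punchIn j k) * Det r (minor₂ M j k))

    expand₂ : ∀ M → Det (suc (suc r)) M ≡ ∑ (suc (suc r)) (λ j → ∑ (suc r) (term M j))
    expand₂ M = trans (Det-suc (suc r) M) (∑-cong (suc (suc r)) λ j → trans
      (cong (λ z → sign (toℕ j) * M zero j * z) (Det-suc r (minor M j)))
      (sym (∑-*ˡ (suc r) (sign (toℕ j) * M zero j) _)))

    cancel : ∀ s t x y x′ y′ d →
      (s * x * (t * y * d) + s * y′ * (t * x′ * d)) + ((- t) * x′ * (s * y′ * d) + (- t) * y * (s * x * d)) ≡ + 0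
    cancel = solve-∀

    antisym : ∀ j k → j Fin.≤ k →
      (term M (inject₁ j) k + term N (inject₁ j) k) + (term M (suc k) j + term N (suc k) j) ≡ + 0
    -- All four minors become the same minor of N; the sign of `suc k` is what differs between the
    -- two orders.
    antisym j k j≤k
      rewrite Det-cong r {minor₂ M (inject₁ j) k} {minor₂ N (inject₁ j) k} (λ a b → M≗N a _)
            | Det-cong r {minor₂ M (suc k) j} {minor₂ N (inject₁ j) k}
                (λ a b → trans (M≗N a _) (cong (N (suc (suc a))) (sym (punchIn-exchange j k j≤k b))))
            | Det-cong r {minor₂ N (suc k) j} {minor₂ N (inject₁ j) k}
                (λ a b → cong (N (suc (suc a))) (sym (punchIn-exchange j k j≤k b)))
            | sign-suc (toℕ k) | Fin.toℕ-inject₁ j | punchIn-inject₁ j k j≤k | punchIn-suc j k j≤k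
            | M₀≗N₁ (inject₁ j) | M₁≗N₀ (suc k) | M₀≗N₁ (suc k) | M₁≗N₀ (inject₁ j) =
      cancel (sign (toℕ j)) (sign (toℕ k)) (N (suc zero) (inject₁ j)) (N zero (suc k))
        (N (suc zero) (suc k)) (N zero (inject₁ j)) (Det r (minor₂ N (inject₁ j) k))

  swap₀₁ : ∀ {r} → Matrix (suc (suc r)) → Matrix (suc (suc r))
  swap₀₁ M zero          = M (suc zero)
  swap₀₁ M (suc zero)    = M zero
  swap₀₁ M (suc (suc a)) = M (suc (suc a))

  x+x≡0⇒x≡0 : ∀ x → x + x ≡ + 0 → x ≡ + 0
  x+x≡0⇒x≡0 x 2x≡0 = *-cancelˡ-≡ (+ 2) x (+ 0) (trans (double x) 2x≡0)
    where
    double : ∀ x → + 2 * x ≡ x + x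
    double = solve-∀

  -- If the first two rows agree, swapping them gives 2 Det = 0. Otherwise the swap moves the first
  -- row into second place, and every minor along the new first row still has two equal rows.
  Det-equal-rows : ∀ {r} (M : Matrix (suc r)) i → (∀ b → M zero b ≡ M (suc i) b) → Det (suc r) M ≡ + 0
  Det-equal-rows {suc r} M zero M₀≗M₁ =
    x+x≡0⇒x≡0 _ (Det-swap r M M M₀≗M₁ (λ b → sym (M₀≗M₁ b)) (λ _ _ → refl))
  Det-equal-rows {suc r} M (suc i) M₀≗Mᵢ = begin
    Det (suc (suc r)) M
      ≡⟨ sym (+-identityˡ _) ⟩
    + 0 + Det (suc (suc r)) M
      ≡⟨ cong (λ z → z + Det (suc (suc r)) M) (sym swapped) ⟩
    Det (suc (suc r)) (swap₀₁ M) + Det (suc (suc r)) M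
      ≡⟨ Det-swap r (swap₀₁ M) M (λ _ → refl) (λ _ → refl) (λ _ _ → refl) ⟩
    + 0 ∎
    where
    open ≡-Reasoning
    swapped : Det (suc (suc r)) (swap₀₁ M) ≡ + 0
    swapped = trans (Det-suc (suc r) _) (∑-0 (suc (suc r)) λ j → trans
      (cong (λ z → sign (toℕ j) * M (suc zero) j * z)
        (Det-equal-rows (minor (swap₀₁ M) j) i (λ b → M₀≗Mᵢ (punchIn j b))))
      (*-zeroʳ (sign (toℕ j) * M (suc zero) j)))

  cons : ∀ {r} → (Fin (suc r) → ℤ) → (Fin r → Fin (suc r) → ℤ) → Matrix (suc r)
  cons u X zero    = u
  cons u X (suc a) = X a

  -- The coefficients are cleared one at a time from the last row upwards; `go k` assumes that they
  -- vanish from index k on. Clearing one changes the determinant by a multiple of a determinant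
  -- with two equal rows.
  Det-add-first-row : ∀ {r} (u : Fin (suc r) → ℤ) (X : Fin r → Fin (suc r) → ℤ) (c : Fin r → ℤ) →
    Det (suc r) (cons u (λ a b → c a * u b + X a b)) ≡ Det (suc r) (cons u X)
  Det-add-first-row {r} u X c = go r c (λ a r≤a → ⊥-elim (ℕ.<⇒≱ (Fin.toℕ<n a) r≤a))
    where
    go : ∀ k c → (∀ a → k ℕ.≤ toℕ a → c a ≡ + 0) →
      Det (suc r) (cons u (λ a b → c a * u b + X a b)) ≡ Det (suc r) (cons u X)
    go zero c c≗0 = Det-cong (suc r) λ
      { zero    b → refl
      ; (suc a) b → trans (cong (λ z → z * u b + X a b) (c≗0 a z≤n)) (+-identityˡ (X a b)) }
    go (suc k) c c≗0 with k ℕ.<? r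
    ... | no k≮r = go k c (λ a k≤a → ⊥-elim (k≮r (ℕ.≤-<-trans k≤a (Fin.toℕ<n a))))
    ... | yes k<r = begin
      Det (suc r) (cons u (λ a b → c a * u b + X a b))
        ≡⟨ Det-linear (suc i) (c i) _ (cons u (λ a b → c′ a * u b + X a b)) N
             (λ b → trans (clear (c i) (u b) (X i b))
               (cong₂ (λ p q → p * u b + X i b + c i * q) (sym c′i≡0) (sym (Nᵢ b))))
             (λ { zero b _ → refl ; (suc a) b a≢i → cong (λ z → z * u b + X a b) (c′a≡ca a (λ e → a≢i (cong suc e))) })
             (λ { zero b _ → refl ; (suc a) b a≢i → N₋ a b (λ e → a≢i (cong suc e)) }) ⟩
      Det (suc r) (cons u (λ a b → c′ a * u b + X a b)) + c i * Det (suc r) N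
        ≡⟨ cong₂ _+_ (go k c′ c′≗0)
             (trans (cong (λ z → c i * z) (Det-equal-rows N i (λ b → sym (Nᵢ b)))) (*-zeroʳ (c i))) ⟩
      Det (suc r) (cons u X) + + 0
        ≡⟨ +-identityʳ _ ⟩
      Det (suc r) (cons u X) ∎
      where
      open ≡-Reasoning
      i = fromℕ< k<r

      c′ : Fin r → ℤ
      c′ a = if does (a Fin.≟ i) then + 0 else c a

      -- Row `suc i` is replaced by u, so it coincides with the first row.
      N : Matrix (suc r)
      N zero    b = u b
      N (suc a) b = if does (a Fin.≟ i) then u b else c a * u b + X a b

      clear : ∀ c u x → c * u + x ≡ + 0 * u + x + c * u
      clear = solve-∀

      c′i≡0 : c′ i ≡ + 0
      c′i≡0 with i Fin.≟ i
      ... | yes _  = refl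
      ... | no i≢i = ⊥-elim (i≢i refl)

      Nᵢ : ∀ b → N (suc i) b ≡ u b
      Nᵢ b with i Fin.≟ i
      ... | yes _  = refl
      ... | no i≢i = ⊥-elim (i≢i refl)

      c′a≡ca : ∀ a → a ≢ i → c a ≡ c′ a
      c′a≡ca a a≢i with a Fin.≟ i
      ... | yes a≡i = ⊥-elim (a≢i a≡i)
      ... | no _    = refl

      N₋ : ∀ a b → a ≢ i → c a * u b + X a b ≡ N (suc a) b
      N₋ a b a≢i with a Fin.≟ i
      ... | yes a≡i = ⊥-elim (a≢i a≡i)
      ... | no _    = refl

      c′≗0 : ∀ a → k ℕ.≤ toℕ a → c′ a ≡ + 0
      c′≗0 a k≤a with a Fin.≟ i
      ... | yes _  = refl
      ... | no a≢i = c≗0 a (ℕ.≤∧≢⇒< k≤a λ k≡a →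
        a≢i (Fin.toℕ-injective (trans (sym k≡a) (sym (Fin.toℕ-fromℕ< k<r)))))

  ∏ : ∀ r → (Fin r → ℤ) → ℤ
  ∏ zero    f = + 1
  ∏ (suc r) f = f zero * ∏ r (λ i → f (suc i))

  Det-lower-triangular : ∀ r (L M : Matrix r) → (∀ a b → toℕ a ℕ.< toℕ b → L a b ≡ + 0) →
    Det r (λ a b → ∑ r (λ c → L a c * M c b)) ≡ ∏ r (λ a → L a a) * Det r M
  Det-lower-triangular zero L M lower =
    trans (Det-cong 0 (λ ())) (sym (*-identityˡ (Det 0 M)))
  Det-lower-triangular (suc r) L M lower = begin
    Det (suc r) (λ a b → ∑ (suc r) (λ c → L a c * M c b))
      ≡⟨ Det-suc r _ ⟩
    ∑ (suc r) (λ j → sign (toℕ j) * ∑ (suc r) (λ c → L zero c * M c j) *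
      Det r (λ a b → ∑ (suc r) (λ c → L (suc a) c * M c (punchIn j b))))
      ≡⟨ ∑-cong (suc r) (λ j → cong₂ (λ y z → sign (toℕ j) * y * z) (first-row j)
           (Det-cong r (λ a b → ∑-suc r _))) ⟩
    ∑ (suc r) (λ j → sign (toℕ j) * (l * M zero j) * Det r (minor N j))
      ≡⟨ ∑-cong (suc r) (λ j → pull (sign (toℕ j)) l (M zero j) (Det r (minor N j))) ⟩
    ∑ (suc r) (λ j → l * (sign (toℕ j) * M zero j * Det r (minor N j)))
      ≡⟨ ∑-*ˡ (suc r) l _ ⟩
    l * ∑ (suc r) (λ j → sign (toℕ j) * M zero j * Det r (minor N j))
      ≡⟨ cong (λ z → l * z) (sym (Det-suc r N)) ⟩
    l * Det (suc r) N
      ≡⟨ cong (λ z → l * z) (Det-add-first-row (M zero) X (λ a → L (suc a) zero)) ⟩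
    l * Det (suc r) (cons (M zero) X)
      ≡⟨ cong (λ z → l * z) (Det-suc r _) ⟩
    l * ∑ (suc r) (λ j → sign (toℕ j) * M zero j * Det r (λ a b → X a (punchIn j b)))
      ≡⟨ cong (λ z → l * z) (∑-cong (suc r) (λ j → cong (λ z → sign (toℕ j) * M zero j * z)
           (Det-lower-triangular r (λ a b → L (suc a) (suc b)) (minor M j)
             (λ a b a<b → lower (suc a) (suc b) (s≤s a<b))))) ⟩
    l * ∑ (suc r) (λ j → sign (toℕ j) * M zero j * (P * Det r (minor M j)))
      ≡⟨ cong (λ z → l * z) (∑-cong (suc r) (λ j → pull′ (sign (toℕ j) * M zero j) P (Det r (minor M j)))) ⟩
    l * ∑ (suc r) (λ j → P * (sign (toℕ j) * M zero j * Det r (minor M j)))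
      ≡⟨ cong (λ z → l * z) (trans (∑-*ˡ (suc r) P _) (cong (λ z → P * z) (sym (Det-suc r M)))) ⟩
    l * (P * Det (suc r) M)
      ≡⟨ sym (*-assoc l P _) ⟩
    l * P * Det (suc r) M ∎
    where
    open ≡-Reasoning
    l = L zero zero
    P = ∏ r (λ a → L (suc a) (suc a))

    X : Fin r → Fin (suc r) → ℤ
    X a b = ∑ r (λ c → L (suc a) (suc c) * M (suc c) b)

    N : Matrix (suc r)
    N = cons (M zero) (λ a b → L (suc a) zero * M zero b + X a b)

    pull : ∀ s l x d → s * (l * x) * d ≡ l * (s * x * d)
    pull = solve-∀

    pull′ : ∀ s l d → s * (l * d) ≡ l * (s * d)
    pull′ = solve-∀

    first-row : ∀ j → ∑ (suc r) (λ c → L zero c * M c j) ≡ l * M zero j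
    first-row j = trans (∑-suc r _) (trans
      (cong (λ z → l * M zero j + z)
        (∑-0 r (λ c → cong (λ z → z * M (suc c) j) (lower zero (suc c) (s≤s z≤n)))))
      (+-identityʳ _))

-- The Gram matrix: factorisation, determinant, independence of the generators.

module GramMatrices where

  open import Data.Integer.Base using (_*_)
  open Sums
  open Determinants

  -- Multiplication by x - 1 on coefficient sequences; equally, the coefficients of Σ uᵢ (xⁱ⁺¹ -
  -- xⁱ).
  difference : (ℕ → ℤ) → ℕ → ℤ
  difference u zero    = - u zero
  difference u (suc i) = u i - u (suc i)

  powXm1-suc : ∀ k i → powXm1 (suc k) i ≡ difference (powXm1 k) i
  powXm1-suc k zero    = refl
  powXm1-suc k (suc i) = refl

  powXm1-above : ∀ {k i} → k ℕ.< i → powXm1 k i ≡ + 0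
  powXm1-above {zero}  {suc i} _         = refl
  powXm1-above {suc k} {suc i} (s≤s k<i) =
    cong₂ _-_ (powXm1-above k<i) (powXm1-above (ℕ.m<n⇒m<1+n k<i))

  powXm1-leading : ∀ k → powXm1 k k ≡ + 1
  powXm1-leading zero    = refl
  powXm1-leading (suc k) = cong₂ _-_ (powXm1-leading k) (powXm1-above (ℕ.n<1+n k))

  -- The Gram matrix of the root basis x − 1 , x² − x , … , xⁿ − xⁿ⁻¹ of Aₙ.
  cartan : ℕ → ℕ → ℤ
  cartan zero          zero          = + 2
  cartan zero          (suc zero)    = - (+ 1)
  cartan zero          (suc (suc b)) = + 0
  cartan (suc a)       (suc b)       = cartan a b
  cartan (suc zero)    zero          = - (+ 1)
  cartan (suc (suc a)) zero          = + 0

  cartan-sym : ∀ a b → cartan a b ≡ cartan b a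
  cartan-sym zero          zero          = refl
  cartan-sym zero          (suc zero)    = refl
  cartan-sym zero          (suc (suc b)) = refl
  cartan-sym (suc zero)    zero          = refl
  cartan-sym (suc (suc a)) zero          = refl
  cartan-sym (suc a)       (suc b)       = cartan-sym a b

  cartanMatrix : ∀ r → Matrix r
  cartanMatrix r a b = cartan (toℕ a) (toℕ b)

  -- Expanding along the first row gives the recursion D(r + 2) = 2 D(r + 1) - D(r) of a tridiagonal
  -- determinant, solved by D(r) = r + 1.
  Det-cartan : ∀ r → Det r (cartanMatrix r) ≡ + suc r
  Det-cartan zero       = Det-zero _
  Det-cartan (suc zero) = trans (Det-suc 0 _) (trans (∑-suc 0 _) (trans
    (cong₂ (λ y z → + 1 * + 2 * y + z) (Det-zero _) (∑-zero _)) refl))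
  Det-cartan (suc (suc r)) = begin
    Det (suc (suc r)) C
      ≡⟨ Det-suc (suc r) C ⟩
    ∑ (suc (suc r)) (λ j → sign (toℕ j) * C zero j * Det (suc r) (minor C j))
      ≡⟨ trans (∑-suc (suc r) _) (cong (λ z → + 2 * Det (suc r) (cartanMatrix (suc r)) + z) (trans (∑-suc r _)
           (cong (λ z → + 1 * Det (suc r) N + z) (∑-0 r (λ j → cong (λ z → z * Det (suc r) (minor C (suc (suc j))))
             (*-zeroʳ (sign (toℕ j)))))))) ⟩
    + 2 * Det (suc r) (cartanMatrix (suc r)) + (+ 1 * Det (suc r) N + + 0)
      ≡⟨ cong₂ (λ y z → + 2 * y + (+ 1 * z + + 0)) (Det-cartan (suc r)) Det-N ⟩
    + 2 * + suc (suc r) + (+ 1 * (- (+ suc r)) + + 0)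
      ≡⟨ arithmetic (+ suc r) ⟩
    + suc (suc (suc r)) ∎
    where
    open ≡-Reasoning
    C = cartanMatrix (suc (suc r))
    N = minor C (suc zero)

    arithmetic : ∀ x → + 2 * (+ 1 + x) + (+ 1 * (- x) + + 0) ≡ + 2 + x
    arithmetic = solve-∀

    -- The first column of `N` is -1, 0, ..., 0, so its expansion, read off from the transpose, has
    -- one term.
    Det-N : Det (suc r) N ≡ - (+ suc r)
    Det-N = begin
      Det (suc r) N
        ≡⟨ sym (Det-transpose (suc r) N) ⟩
      Det (suc r) (N ᵀ)
        ≡⟨ trans (Det-suc r (N ᵀ)) (∑-suc r _) ⟩
      - (+ 1) * Det r (cartanMatrix r ᵀ) +
        ∑ r (λ j → sign (suc (toℕ j)) * + 0 * Det r (minor (N ᵀ) (suc j)))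
        ≡⟨ cong₂ (λ y z → - (+ 1) * y + z) (trans (Det-transpose r (cartanMatrix r)) (Det-cartan r))
             (∑-0 r (λ j → cong (λ z → z * Det r (minor (N ᵀ) (suc j))) (*-zeroʳ (sign (suc (toℕ j)))))) ⟩
      - (+ 1) * + suc r + + 0
        ≡⟨ trans (+-identityʳ _) (-1*i≡-i (+ suc r)) ⟩
      - (+ suc r) ∎

  -- Only the summand e = 0 survives. For n = 0 the sum is empty, and the hypothesis says that f 0 =
  -- 0.
  ∑-cartan-first : ∀ n (f : ℕ → ℤ) → f n ≡ + 0 → ∑ n (λ e → cartan 0 (suc (toℕ e)) * f (toℕ e)) ≡ - f 0
  ∑-cartan-first zero    f f0≡0 = trans (∑-zero _) (cong -_ (sym f0≡0))
  ∑-cartan-first (suc n) f _    = trans (∑-suc n _) (trans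
    (cong₂ _+_ (-1*i≡-i (f 0)) (∑-0 n (λ _ → refl))) (+-identityʳ (- f 0)))

  -- Both sides are the inner product of Σ uᵢ (xⁱ⁺¹ - xⁱ) and Σ wᵢ (xⁱ⁺¹ - xⁱ). The sequences must
  -- vanish at n because `difference` at index n involves that entry. Induction removes the first
  -- index.
  cartan-form : ∀ n (u w : ℕ → ℤ) → u n ≡ + 0 → w n ≡ + 0 →
    ∑ n (λ c → u (toℕ c) * ∑ n (λ e → cartan (toℕ c) (toℕ e) * w (toℕ e))) ≡
    ∑ (suc n) (λ i → difference u (toℕ i) * difference w (toℕ i))
  cartan-form zero u w u0≡0 w0≡0 = trans (∑-zero _) (sym (trans (∑-suc 0 _)
    (cong₂ _+_ (cong (λ z → - z * - w 0) u0≡0) (∑-zero _))))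
  cartan-form (suc n) u w uₙ≡0 wₙ≡0 = begin
    ∑ (suc n) (λ c → u (toℕ c) * ∑ (suc n) (λ e → cartan (toℕ c) (toℕ e) * w (toℕ e)))
      ≡⟨ ∑-suc n _ ⟩
    u 0 * ∑ (suc n) (λ e → cartan 0 (toℕ e) * w (toℕ e)) +
      ∑ n (λ c → u′ (toℕ c) * ∑ (suc n) (λ e → cartan (suc (toℕ c)) (toℕ e) * w (toℕ e)))
      ≡⟨ cong₂ (λ y z → u 0 * y + z)
           (trans (∑-suc n _) (cong (λ z → + 2 * w 0 + z) (∑-cartan-first n w′ wₙ≡0)))
           (trans (∑-cong n row) (trans (∑-+ n _ _) (cong (λ z → z + Q)
             (trans (∑-*ʳ n (w 0) _) (cong (λ z → z * w 0) (∑-cartan-first n u′ uₙ≡0)))))) ⟩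
    u 0 * (+ 2 * w 0 + - w 1) + (- u 1 * w 0 + Q)
      ≡⟨ cong (λ z → u 0 * (+ 2 * w 0 + - w 1) + (- u 1 * w 0 + z))
           (trans (cartan-form n u′ w′ uₙ≡0 wₙ≡0) (∑-suc n _)) ⟩
    u 0 * (+ 2 * w 0 + - w 1) + (- u 1 * w 0 + (- u 1 * - w 1 + R))
      ≡⟨ rearrange (u 0) (w 0) (u 1) (w 1) R ⟩
    - u 0 * - w 0 + ((u 0 - u 1) * (w 0 - w 1) + R)
      ≡⟨ sym (trans (∑-suc (suc n) _) (cong (λ z → - u 0 * - w 0 + z) (∑-suc n _))) ⟩
    ∑ (suc (suc n)) (λ i → difference u (toℕ i) * difference w (toℕ i)) ∎
    where
    open ≡-Reasoning
    u′ w′ : ℕ → ℤ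
    u′ i = u (suc i)
    w′ i = w (suc i)

    Q = ∑ n (λ c → u′ (toℕ c) * ∑ n (λ e → cartan (toℕ c) (toℕ e) * w′ (toℕ e)))
    R = ∑ n (λ i → (u′ (toℕ i) - u′ (suc (toℕ i))) * (w′ (toℕ i) - w′ (suc (toℕ i))))

    regroup : ∀ u k w y → u * (k * w + y) ≡ k * u * w + u * y
    regroup = solve-∀

    row : ∀ c → u′ (toℕ c) * ∑ (suc n) (λ e → cartan (suc (toℕ c)) (toℕ e) * w (toℕ e)) ≡
      cartan 0 (suc (toℕ c)) * u′ (toℕ c) * w 0 + u′ (toℕ c) * ∑ n (λ e → cartan (toℕ c) (toℕ e) * w′ (toℕ e))
    row c = trans (cong (λ z → u′ (toℕ c) * z) (trans (∑-suc n _)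
        (cong (λ z → z * w 0 + ∑ n (λ e → cartan (toℕ c) (toℕ e) * w′ (toℕ e))) (cartan-sym (suc (toℕ c)) 0))))
      (regroup (u′ (toℕ c)) (cartan 0 (suc (toℕ c))) (w 0) (∑ n (λ e → cartan (toℕ c) (toℕ e) * w′ (toℕ e))))

    rearrange : ∀ u₀ w₀ u₁ w₁ r → u₀ * (+ 2 * w₀ + - w₁) + (- u₁ * w₀ + (- u₁ * - w₁ + r)) ≡
      - u₀ * - w₀ + ((u₀ - u₁) * (w₀ - w₁) + r)
    rearrange = solve-∀

  -- Index k belongs to (x - 1)ᵏ⁺¹, hence the successor in the test.
  scale : (m l k : ℕ) → ℤ
  scale m l k = if suc k <ᵇ m then + l else + 1

  module _ (n m l : ℕ) where

    -- The triangular factor L: row a holds the coordinates of generator a in the root basis xᵇ⁺¹ -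
    -- xᵇ.
    change : Matrix n
    change a b = scale m l (toℕ a) * powXm1 (toℕ a) (toℕ b)

    gram-factor : ∀ a b → gram n m l a b ≡
      ∑ n (λ c → change a c * ∑ n (λ e → change b e * cartanMatrix n c e))
    gram-factor a b = begin
      gram n m l a b
        ≡⟨ sym (∑-sumFin (suc n) _) ⟩
      ∑ (suc n) (λ i → s * powXm1 (suc (toℕ a)) (toℕ i) * (t * powXm1 (suc (toℕ b)) (toℕ i)))
        ≡⟨ ∑-cong (suc n) (λ i → trans
             (cong₂ (λ y z → s * y * (t * z)) (powXm1-suc (toℕ a) (toℕ i)) (powXm1-suc (toℕ b) (toℕ i)))
             (regroup s t (difference p (toℕ i)) (difference q (toℕ i)))) ⟩
      ∑ (suc n) (λ i → s * t * (difference p (toℕ i) * difference q (toℕ i)))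
        ≡⟨ ∑-*ˡ (suc n) (s * t) _ ⟩
      s * t * ∑ (suc n) (λ i → difference p (toℕ i) * difference q (toℕ i))
        ≡⟨ cong (λ z → s * t * z) (sym (cartan-form n p q
             (powXm1-above (Fin.toℕ<n a)) (powXm1-above (Fin.toℕ<n b)))) ⟩
      s * t * ∑ n (λ c → p (toℕ c) * ∑ n (λ e → cartanMatrix n c e * q (toℕ e)))
        ≡⟨ sym (∑-*ˡ n (s * t) _) ⟩
      ∑ n (λ c → s * t * (p (toℕ c) * ∑ n (λ e → cartanMatrix n c e * q (toℕ e))))
        ≡⟨ ∑-cong n (λ c → trans (regroup′ s t (p (toℕ c)) (∑ n (λ e → cartanMatrix n c e * q (toℕ e))))
             (cong (λ z → s * p (toℕ c) * z) (trans (sym (∑-*ˡ n t _))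
               (∑-cong n (λ e → regroup″ t (cartanMatrix n c e) (q (toℕ e))))))) ⟩
      ∑ n (λ c → change a c * ∑ n (λ e → change b e * cartanMatrix n c e)) ∎
      where
      open ≡-Reasoning
      s = scale m l (toℕ a)
      t = scale m l (toℕ b)
      p = powXm1 (toℕ a)
      q = powXm1 (toℕ b)

      regroup : ∀ s t x y → s * x * (t * y) ≡ s * t * (x * y)
      regroup = solve-∀

      regroup′ : ∀ s t x y → s * t * (x * y) ≡ s * x * (t * y)
      regroup′ = solve-∀

      regroup″ : ∀ t k q → t * (k * q) ≡ t * q * k
      regroup″ = solve-∀

    change-lower : ∀ a b → toℕ a ℕ.< toℕ b → change a b ≡ + 0
    change-lower a b a<b = trans (cong (λ z → scale m l (toℕ a) * z) (powXm1-above a<b)) (*-zeroʳ (scale m l (toℕ a)))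

  ∏-cong : ∀ r {f g : Fin r → ℤ} → (∀ i → f i ≡ g i) → ∏ r f ≡ ∏ r g
  ∏-cong zero    f≗g = refl
  ∏-cong (suc r) f≗g = cong₂ _*_ (f≗g zero) (∏-cong r (λ i → f≗g (suc i)))

  ∏-scale : ∀ n k l → k ℕ.≤ n → ∏ n (λ a → scale (suc k) l (toℕ a)) ≡ + (l ℕ.^ k)
  ∏-scale zero    zero    l _         = refl
  ∏-scale (suc n) zero    l _         = trans (*-identityˡ _) (∏-scale n zero l z≤n)
  ∏-scale (suc n) (suc k) l (s≤s k≤n) = trans (cong (λ z → + l * z) (∏-scale n k l k≤n)) (sym (pos-* l (l ℕ.^ k)))

  det-gram : ∀ n k l → k ℕ.≤ n → det n (gram n (suc k) l) ≡ + (l ℕ.^ k ℕ.* l ℕ.^ k ℕ.* suc n)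
  det-gram n k l k≤n = begin
    det n (gram n m l)
      ≡⟨ trans (sym (Det-det n (gram n m l))) (Det-cong n (gram-factor n m l)) ⟩
    Det n (λ a b → ∑ n (λ c → L a c * M c b))
      ≡⟨ Det-lower-triangular n L M (change-lower n m l) ⟩
    ∏ n (λ a → L a a) * Det n M
      -- The transpose of `M` is L times the transposed Cartan matrix, so the triangular lemma
      -- applies a second time.
      ≡⟨ cong (λ z → ∏ n (λ a → L a a) * z) (trans (sym (Det-transpose n M))
           (Det-lower-triangular n L (cartanMatrix n ᵀ) (change-lower n m l))) ⟩
    ∏ n (λ a → L a a) * (∏ n (λ a → L a a) * Det n (cartanMatrix n ᵀ))
      ≡⟨ cong₂ (λ y z → y * (y * z)) (trans (∏-cong n diagonal) (∏-scale n k l k≤n))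
           (trans (Det-transpose n (cartanMatrix n)) (Det-cartan n)) ⟩
    + (l ℕ.^ k) * (+ (l ℕ.^ k) * + suc n)
      ≡⟨ sym (*-assoc (+ (l ℕ.^ k)) (+ (l ℕ.^ k)) (+ suc n)) ⟩
    + (l ℕ.^ k) * + (l ℕ.^ k) * + suc n
      ≡⟨ sym (trans (pos-* (l ℕ.^ k ℕ.* l ℕ.^ k) (suc n)) (cong (λ z → z * + suc n) (pos-* (l ℕ.^ k) (l ℕ.^ k)))) ⟩
    + (l ℕ.^ k ℕ.* l ℕ.^ k ℕ.* suc n) ∎
    where
    open ≡-Reasoning
    m = suc k
    L = change n m l

    M : Matrix n
    M c b = ∑ n (λ e → L b e * cartanMatrix n c e)

    diagonal : ∀ a → L a a ≡ scale m l (toℕ a)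
    diagonal a = trans (cong (λ z → scale m l (toℕ a) * z) (powXm1-leading (toℕ a))) (*-identityʳ _)

  -- Write the combination as (x - 1) q + a₀. Its vanishing makes the coefficients of q constant,
  -- and one of them lies above the degree of q; so a₀ = 0, q vanishes, and induction applies to q.
  powXm1-independent : ∀ d (a : Fin d → ℤ) →
    (∀ i → i ℕ.< d → ∑ d (λ j → a j * powXm1 (toℕ j) i) ≡ + 0) → ∀ j → a j ≡ + 0
  powXm1-independent (suc d) a vanish = λ
    { zero    → a₀≡0
    ; (suc j) → powXm1-independent d (λ j → a (suc j)) (λ i i<d → trans (q≡a₀ i (ℕ.<⇒≤ i<d)) a₀≡0) j }
    where
    q : ℕ → ℤ
    q i = ∑ d (λ j → a (suc j) * powXm1 (toℕ j) i)

    constant : ∀ a₀ x → a₀ * + 1 + - x ≡ + 0 → x ≡ a₀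
    constant a₀ x eq = sym (i-j≡0⇒i≡j a₀ x (trans (cong (λ z → z + - x) (sym (*-identityʳ a₀))) eq))

    -- (x − 1) q + a₀ ≡ 0 makes all the coefficients of q up to degree d equal to a₀.
    q≡a₀ : ∀ i → i ℕ.≤ d → q i ≡ a zero
    q≡a₀ zero _ = constant (a zero) (q 0) (trans
      (cong (λ z → a zero * + 1 + z) (trans (sym (-1*i≡-i (q 0))) (trans (sym (∑-*ˡ d (- (+ 1)) _))
        (∑-cong d (λ j → trans (-1*i≡-i _) (neg-distribʳ-* (a (suc j)) (powXm1 (toℕ j) 0)))))))
      (trans (sym (∑-suc d _)) (vanish 0 (s≤s z≤n))))
    q≡a₀ (suc i) i<d = trans (sym (i-j≡0⇒i≡j (q i) (q (suc i)) (begin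
      q i - q (suc i)
        ≡⟨ sym (∑-- d _ _) ⟩
      ∑ d (λ j → a (suc j) * powXm1 (toℕ j) i - a (suc j) * powXm1 (toℕ j) (suc i))
        ≡⟨ ∑-cong d (λ j → sym (distrib (a (suc j)) (powXm1 (toℕ j) i) (powXm1 (toℕ j) (suc i)))) ⟩
      ∑ d (λ j → a (suc j) * powXm1 (suc (toℕ j)) (suc i))
        ≡⟨ sym (trans (cong (λ z → z + ∑ d (λ j → a (suc j) * powXm1 (suc (toℕ j)) (suc i))) (*-zeroʳ (a zero)))
             (+-identityˡ _)) ⟩
      a zero * + 0 + ∑ d (λ j → a (suc j) * powXm1 (suc (toℕ j)) (suc i))
        ≡⟨ sym (∑-suc d _) ⟩
      ∑ (suc d) (λ j → a j * powXm1 (toℕ j) (suc i))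
        ≡⟨ vanish (suc i) (s≤s i<d) ⟩
      + 0 ∎))) (q≡a₀ i (ℕ.<⇒≤ i<d))
      where
      open ≡-Reasoning
      distrib : ∀ a x y → a * (x - y) ≡ a * x - a * y
      distrib = solve-∀

    a₀≡0 : a zero ≡ + 0
    a₀≡0 = trans (sym (q≡a₀ d ℕ.≤-refl)) (∑-0 d (λ j →
      trans (cong (λ z → a (suc j) * z) (powXm1-above (Fin.toℕ<n j))) (*-zeroʳ (a (suc j)))))

  scale-positive : ∀ m {l} k → 0 ℕ.< l → scale m l k ≢ + 0
  scale-positive m {suc l} k _ with suc k <ᵇ m
  ... | true  = λ ()
  ... | false = λ ()

  gen-independent : ∀ n m l → 0 ℕ.< l → (c : Fin n → ℤ) → (∀ i → comb n m l c i ≡ + 0) → ∀ j → c j ≡ + 0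
  gen-independent n m l 0<l c vanish j with i*j≡0⇒i≡0∨j≡0 (c j) {scale m l (toℕ j)}
      (powXm1-independent (suc n) a (λ i i≤n → begin
        ∑ (suc n) (λ j → a j * powXm1 (toℕ j) i)
          ≡⟨ trans (∑-suc n _) (+-identityˡ _) ⟩
        ∑ n (λ j → c j * scale m l (toℕ j) * powXm1 (suc (toℕ j)) i)
          ≡⟨ ∑-cong n (λ j → trans (*-assoc (c j) _ _)
               (cong (λ z → c j * (scale m l (toℕ j) * powXm1 (suc (toℕ j)) z)) (sym (Fin.toℕ-fromℕ< i≤n)))) ⟩
        ∑ n (λ j → c j * gen n m l j (fromℕ< i≤n))
          ≡⟨ trans (∑-sumFin n _) (vanish (fromℕ< i≤n)) ⟩
        + 0 ∎) (suc j))
    where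
    open ≡-Reasoning
    -- The generators start with x - 1, so (x - 1)⁰ gets the coefficient 0.
    a : Fin (suc n) → ℤ
    a zero    = + 0
    a (suc j) = c j * scale m l (toℕ j)
  ... | inj₁ cⱼ≡0 = cⱼ≡0
  ... | inj₂ s≡0  = ⊥-elim (scale-positive m (toℕ j) 0<l s≡0)

-- Newton's identities and lists with power sums congruent modulo a prime.

module NewtonIdentities where

  open import Data.Integer.Base using (_*_; _^_)

  elementary : List ℤ → ℕ → ℤ
  elementary []       zero    = + 1
  elementary []       (suc k) = + 0
  elementary (x ∷ xs) zero    = + 1
  elementary (x ∷ xs) (suc k) = elementary xs (suc k) + x * elementary xs k

  powerSum : List ℤ → ℕ → ℤ
  powerSum []       i = + 0
  powerSum (x ∷ xs) i = x ^ i + powerSum xs i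

  elementary-zero : ∀ xs → elementary xs 0 ≡ + 1
  elementary-zero []       = refl
  elementary-zero (x ∷ xs) = refl

  elementary-above : ∀ xs {k} → length xs ℕ.< k → elementary xs k ≡ + 0
  elementary-above []       {suc k} _         = refl
  elementary-above (x ∷ xs) {suc k} (s≤s n<k) = trans
    (cong₂ (λ y z → y + x * z) (elementary-above xs (ℕ.m<n⇒m<1+n n<k)) (elementary-above xs n<k))
    (trans (+-identityˡ (x * + 0)) (*-zeroʳ x))

  -- alternating xs q k = Σ_{i=1}^{k} (−1)^{i−1} e_{k−i}(xs) q i, the sum in Newton's identities.
  alternating : List ℤ → (ℕ → ℤ) → ℕ → ℤ
  alternating xs q zero    = + 0
  alternating xs q (suc k) = elementary xs k * q 1 - alternating xs (λ i → q (suc i)) k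

  alternating-+ : ∀ xs q r k → alternating xs (λ i → q i + r i) k ≡ alternating xs q k + alternating xs r k
  alternating-+ xs q r zero    = refl
  alternating-+ xs q r (suc k) = trans
    (cong (λ z → elementary xs k * (q 1 + r 1) - z) (alternating-+ xs (λ i → q (suc i)) (λ i → r (suc i)) k))
    (distrib (elementary xs k) (q 1) (r 1) (alternating xs (λ i → q (suc i)) k) (alternating xs (λ i → r (suc i)) k))
    where
    distrib : ∀ e q r x y → e * (q + r) - (x + y) ≡ (e * q - x) + (e * r - y)
    distrib = solve-∀

  alternating-* : ∀ xs c q k → alternating xs (λ i → c * q i) k ≡ c * alternating xs q k
  alternating-* xs c q zero    = sym (*-zeroʳ c)
  alternating-* xs c q (suc k) = trans
    (cong (λ z → elementary xs k * (c * q 1) - z) (alternating-* xs c (λ i → q (suc i)) k))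
    (distrib (elementary xs k) c (q 1) (alternating xs (λ i → q (suc i)) k))
    where
    distrib : ∀ e c q x → e * (c * q) - c * x ≡ c * (e * q - x)
    distrib = solve-∀

  -- The recursion of `elementary`, summed. The second sum stops one index earlier, since e₀ has no
  -- summand with factor x.
  alternating-cons : ∀ x xs q k →
    alternating (x ∷ xs) q (suc k) ≡ alternating xs q (suc k) + x * alternating xs q k
  alternating-cons x xs q zero rewrite elementary-zero xs = base (q 1) x
    where
    base : ∀ q x → + 1 * q - + 0 ≡ + 1 * q - + 0 + x * + 0
    base = solve-∀
  alternating-cons x xs q (suc k) = trans
    (cong (λ z → (elementary xs (suc k) + x * elementary xs k) * q 1 - z) (alternating-cons x xs (λ i → q (suc i)) k))
    (distrib (elementary xs (suc k)) (elementary xs k) x (q 1)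
      (alternating xs (λ i → q (suc i)) (suc k)) (alternating xs (λ i → q (suc i)) k))
    where
    distrib : ∀ e f x q a b → (e + x * f) * q - (a + x * b) ≡ (e * q - a) + x * (f * q - b)
    distrib = solve-∀

  -- Raising the exponents by one multiplies the sum by x, so the tail of the first sum cancels the
  -- second sum in `alternating-cons`.
  alternating-powers : ∀ x xs k → alternating (x ∷ xs) (x ^_) (suc k) ≡ x * elementary xs k
  alternating-powers x xs k = trans (alternating-cons x xs (x ^_) k) (trans
    (cong (λ z → elementary xs k * (x * + 1) - z + x * alternating xs (x ^_) k) (alternating-* xs x (x ^_) k))
    (cancel (elementary xs k) x (alternating xs (x ^_) k)))
    where
    cancel : ∀ e x a → e * (x * + 1) - x * a + x * a ≡ x * e
    cancel = solve-∀

  -- Induction on the list: the powers of the new entry are handled by `alternating-powers`, the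
  -- remaining power sums by the hypotheses in degrees k + 1 and k.
  newton : ∀ xs k → alternating xs (powerSum xs) k ≡ + k * elementary xs k
  newton xs       zero    = refl
  newton []       (suc k) = trans
    (cong₂ _-_ (*-zeroʳ (elementary [] k)) (alternating-* [] (+ 0) (λ _ → + 0) k)) (sym (*-zeroʳ (+ suc k)))
  newton (x ∷ xs) (suc k) = begin
    alternating (x ∷ xs) (powerSum (x ∷ xs)) (suc k)
      ≡⟨ alternating-+ (x ∷ xs) (x ^_) (powerSum xs) (suc k) ⟩
    alternating (x ∷ xs) (x ^_) (suc k) + alternating (x ∷ xs) (powerSum xs) (suc k)
      ≡⟨ cong₂ _+_ (alternating-powers x xs k) (trans (alternating-cons x xs (powerSum xs) k)
           (cong₂ (λ y z → y + x * z) (newton xs (suc k)) (newton xs k))) ⟩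
    x * elementary xs k + (+ suc k * elementary xs (suc k) + x * (+ k * elementary xs k))
      ≡⟨ collect x (elementary xs k) (elementary xs (suc k)) (+ k) ⟩
    + suc k * (elementary xs (suc k) + x * elementary xs k) ∎
    where
    open ≡-Reasoning
    collect : ∀ x e f k → x * e + ((+ 1 + k) * f + x * (k * e)) ≡ (+ 1 + k) * (f + x * e)
    collect = solve-∀

  -- The polynomial f 0 tᵏ + f 1 tᵏ⁻¹ + ... + f k, with the leading coefficient first.
  horner : (ℕ → ℤ) → ℤ → ℕ → ℤ
  horner f t zero    = f 0
  horner f t (suc k) = t * horner f t k + f (suc k)

  shiftedProduct : ℤ → List ℤ → ℤ
  shiftedProduct t []       = + 1
  shiftedProduct t (x ∷ xs) = (t + x) * shiftedProduct t xs

  horner-elementary-cons : ∀ x xs t k → horner (elementary (x ∷ xs)) t (suc k) ≡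
    horner (elementary xs) t (suc k) + x * horner (elementary xs) t k
  horner-elementary-cons x xs t zero rewrite elementary-zero xs = base t (elementary xs 1) x
    where
    base : ∀ t e x → t * + 1 + (e + x * + 1) ≡ t * + 1 + e + x * + 1
    base = solve-∀
  horner-elementary-cons x xs t (suc k) = trans
    (cong (λ z → t * z + (elementary xs (suc (suc k)) + x * elementary xs (suc k))) (horner-elementary-cons x xs t k))
    (distrib t (horner (elementary xs) t (suc k)) (horner (elementary xs) t k) x
      (elementary xs (suc (suc k))) (elementary xs (suc k)))
    where
    distrib : ∀ t a b x e f → t * (a + x * b) + (e + x * f) ≡ t * a + e + x * (t * b + f)
    distrib = solve-∀

  shiftedProduct-horner : ∀ t xs → shiftedProduct t xs ≡ horner (elementary xs) t (length xs)
  shiftedProduct-horner t []       = refl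
  shiftedProduct-horner t (x ∷ xs) = begin
    (t + x) * shiftedProduct t xs
      ≡⟨ cong (λ z → (t + x) * z) (shiftedProduct-horner t xs) ⟩
    (t + x) * h
      ≡⟨ expand t x h ⟩
    t * h + + 0 + x * h
      -- The elementary symmetric function just beyond the length is 0, which allows one more Horner
      -- step.
      ≡⟨ cong (λ z → t * h + z + x * h) (sym (elementary-above xs (ℕ.n<1+n (length xs)))) ⟩
    horner (elementary xs) t (suc (length xs)) + x * h
      ≡⟨ sym (horner-elementary-cons x xs t (length xs)) ⟩
    horner (elementary (x ∷ xs)) t (suc (length xs)) ∎
    where
    open ≡-Reasoning
    h = horner (elementary xs) t (length xs)
    expand : ∀ t x h → (t + x) * h ≡ t * h + + 0 + x * h
    expand = solve-∀

  shiftedProduct-root : ∀ {y ys} → y ∈ ys → shiftedProduct (- y) ys ≡ + 0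
  shiftedProduct-root {y} {ys = _ ∷ ys} (here refl) =
    cong (λ z → z * shiftedProduct (- y) ys) (+-inverseˡ y)
  shiftedProduct-root {y} {ys = x ∷ ys} (there y∈ys) =
    trans (cong (λ z → (- y + x) * z) (shiftedProduct-root y∈ys)) (*-zeroʳ (- y + x))

  ∣-by : ∀ {d i j} → i ≡ j → d ∣ i → d ∣ j
  ∣-by {d} i≡j = subst (d ∣_) i≡j

  ∣0 : ∀ d → d ∣ + 0
  ∣0 d = divides (+ 0) refl

  prime-∣-* : ∀ {l} → Prime l → ∀ i j → + l ∣ i * j → + l ∣ i ⊎ + l ∣ j
  prime-∣-* {l} l-prime i j l∣ij = Sum.map ∣ᵤ⇒∣ ∣ᵤ⇒∣
    (euclidsLemma (abs i) (abs j) l-prime (subst (l ℕ.∣_) (abs-* i j) (∣⇒∣ᵤ l∣ij)))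

  module _ {l : ℕ} (l-prime : Prime l) where

    alternating-≡mod : ∀ xs ys q r k →
      (∀ j → j ℕ.< k → + l ∣ elementary xs j - elementary ys j) →
      (∀ i → 1 ℕ.≤ i → i ℕ.≤ k → + l ∣ q i - r i) →
      + l ∣ alternating xs q k - alternating ys r k
    alternating-≡mod xs ys q r zero    _  _  = ∣0 (+ l)
    alternating-≡mod xs ys q r (suc k) hₑ hᵣ = ∣-by
      (sym (split (elementary xs k) (elementary ys k) (q 1) (r 1)
        (alternating xs (λ i → q (suc i)) k) (alternating ys (λ i → r (suc i)) k)))
      (∣m∣n⇒∣m-n
        (∣m∣n⇒∣m+n (∣n⇒∣m*n (q 1) (hₑ k ℕ.≤-refl)) (∣n⇒∣m*n (elementary ys k) (hᵣ 1 ℕ.≤-refl (s≤s z≤n))))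
        (alternating-≡mod xs ys (λ i → q (suc i)) (λ i → r (suc i)) k
          (λ j j<k → hₑ j (ℕ.m<n⇒m<1+n j<k)) (λ i 1≤i i≤k → hᵣ (suc i) (s≤s z≤n) (s≤s i≤k))))
      where
      split : ∀ e f q r x y → (e * q - x) - (f * r - y) ≡ (q * (e - f) + f * (q - r)) - (x - y)
      split = solve-∀

    horner-≡mod : ∀ f g t k → (∀ j → j ℕ.≤ k → + l ∣ f j - g j) → + l ∣ horner f t k - horner g t k
    horner-≡mod f g t zero    h = h 0 z≤n
    horner-≡mod f g t (suc k) h = ∣-by
      (sym (split t (horner f t k) (horner g t k) (f (suc k)) (g (suc k))))
      (∣m∣n⇒∣m+n (∣n⇒∣m*n t (horner-≡mod f g t k (λ j j≤k → h j (ℕ.m≤n⇒m≤1+n j≤k)))) (h (suc k) ℕ.≤-refl))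
      where
      split : ∀ t a b x y → (t * a + x) - (t * b + y) ≡ t * (a - b) + (x - y)
      split = solve-∀

    module _ (xs ys : List ℤ) (N : ℕ) (N<l : N ℕ.< l)
      (powerSums : ∀ i → 1 ℕ.≤ i → i ℕ.≤ N → + l ∣ powerSum xs i - powerSum ys i) where

      -- Newton's identities show that l divides k + 1 times the difference, and l cannot divide k +
      -- 1 because 0 < k + 1 ≤ N < l.
      elementary-≡mod-step : ∀ k → suc k ℕ.≤ N → (∀ j → j ℕ.< suc k → + l ∣ elementary xs j - elementary ys j) →
        + l ∣ elementary xs (suc k) - elementary ys (suc k)
      elementary-≡mod-step k k<N below = Sum.[ (λ l∣k → ⊥-elim (ℕ.<⇒≱ (ℕ.≤-<-trans k<N N<l) (ℕ.∣⇒≤ (∣⇒∣ᵤ l∣k)))) , id ]′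
        (prime-∣-* l-prime (+ suc k) (elementary xs (suc k) - elementary ys (suc k))
          (∣-by (trans (cong₂ _-_ (newton xs (suc k)) (newton ys (suc k)))
                  (factor (+ suc k) (elementary xs (suc k)) (elementary ys (suc k))))
            (alternating-≡mod xs ys (powerSum xs) (powerSum ys) (suc k) below
              (λ i 1≤i i≤k → powerSums i 1≤i (ℕ.≤-trans i≤k k<N)))))
        where
        factor : ∀ k e f → k * e - k * f ≡ k * (e - f)
        factor = solve-∀

      elementary-≡mod-below : ∀ k → k ℕ.≤ suc N → ∀ j → j ℕ.< k → + l ∣ elementary xs j - elementary ys j
      elementary-≡mod-below (suc k) (s≤s k≤N) j j<1+k with ℕ.m<1+n⇒m<n∨m≡n j<1+k
      ... | inj₁ j<k = elementary-≡mod-below k (ℕ.m≤n⇒m≤1+n k≤N) j j<k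
      elementary-≡mod-below (suc zero) _ .0 _ | inj₂ refl =
        ∣-by (sym (i≡j⇒i-j≡0 (trans (elementary-zero xs) (sym (elementary-zero ys))))) (∣0 (+ l))
      elementary-≡mod-below (suc (suc k)) (s≤s k<N) .(suc k) _ | inj₂ refl =
        elementary-≡mod-step k k<N (elementary-≡mod-below (suc k) (ℕ.m≤n⇒m≤1+n k<N))

    prime-∣-shiftedProduct : ∀ t xs → + l ∣ shiftedProduct t xs → ∃ λ x → x ∈ xs × + l ∣ t + x
    prime-∣-shiftedProduct t []       l∣1 =
      ⊥-elim (¬prime[1] (subst Prime (ℕ.∣1⇒≡1 (∣⇒∣ᵤ l∣1)) l-prime))
    prime-∣-shiftedProduct t (x ∷ xs) l∣p with prime-∣-* l-prime (t + x) (shiftedProduct t xs) l∣p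
    ... | inj₁ l∣t+x = x , here refl , l∣t+x
    ... | inj₂ l∣p′  with prime-∣-shiftedProduct t xs l∣p′
    ...   | z , z∈xs , l∣t+z = z , there z∈xs , l∣t+z

    -- The polynomials ∏ (t + xᵢ) and ∏ (t + yᵢ) have congruent coefficients, and the second has the
    -- root -y. So l divides the first one at t = -y, hence one of its factors.
    common-residue : ∀ xs ys → length xs ≡ length ys → length xs ℕ.< l →
      (∀ i → 1 ℕ.≤ i → i ℕ.≤ length xs → + l ∣ powerSum xs i - powerSum ys i) →
      ∀ {y} → y ∈ ys → ∃ λ x → x ∈ xs × + l ∣ - y + x
    common-residue xs ys len N<l powerSums {y} y∈ys =
      prime-∣-shiftedProduct (- y) xs (∣-by (begin
        horner (elementary xs) (- y) (length xs) - horner (elementary ys) (- y) (length xs)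
          ≡⟨ cong₂ _-_ (sym (shiftedProduct-horner (- y) xs))
               (trans (cong (horner (elementary ys) (- y)) len) (sym (shiftedProduct-horner (- y) ys))) ⟩
        shiftedProduct (- y) xs - shiftedProduct (- y) ys
          ≡⟨ cong (λ z → shiftedProduct (- y) xs - z) (shiftedProduct-root y∈ys) ⟩
        shiftedProduct (- y) xs - + 0
          ≡⟨ +-identityʳ _ ⟩
        shiftedProduct (- y) xs ∎)
        (horner-≡mod (elementary xs) (elementary ys) (- y) (length xs) (λ j j≤N →
          elementary-≡mod-below xs ys (length xs) N<l powerSums (suc (length xs)) ℕ.≤-refl j (s≤s j≤N))))
      where open ≡-Reasoning

-- The minimum norm: moments of lattice vectors.

module ShortVectors where

  open import Data.Integer.Base using (_*_; _^_)
  open Sums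
  open GramMatrices
  open NewtonIdentities

  Δ : (ℕ → ℤ) → ℕ → ℤ
  Δ g i = g (suc i) - g i

  moment : ℕ → ℕ → (ℕ → ℤ) → ℤ
  moment n j g = ∑ (suc n) (λ i → powXm1 j (toℕ i) * g (toℕ i))

  -- Pairing with (x − 1)ʲ takes the j-th finite difference at 0 (summation by parts).
  moment-suc : ∀ {n j} g → j ℕ.< n → moment n (suc j) g ≡ moment n j (Δ g)
  moment-suc {n} {j} g j<n = begin
    moment n (suc j) g
      ≡⟨ ∑-suc n _ ⟩
    - p 0 * g 0 + ∑ n (λ i → (p (toℕ i) - p (suc (toℕ i))) * g (suc (toℕ i)))
      ≡⟨ cong (λ z → - p 0 * g 0 + z) (trans
           (∑-cong n (λ i → distribʳ (p (toℕ i)) (p (suc (toℕ i))) (g (suc (toℕ i))))) (∑-- n _ _)) ⟩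
    - p 0 * g 0 + (A - B)
      ≡⟨ rearrange (p 0) (g 0) A B (g (suc n)) ⟩
    (A + + 0 * g (suc n)) - (p 0 * g 0 + B)
      ≡⟨ cong₂ _-_ (trans (cong (λ z → A + z * g (suc n)) (sym (powXm1-above j<n)))
           (sym (∑-snoc n (λ i → p i * g (suc i))))) (sym (∑-suc n _)) ⟩
    ∑ (suc n) (λ i → p (toℕ i) * g (suc (toℕ i))) - ∑ (suc n) (λ i → p (toℕ i) * g (toℕ i))
      ≡⟨ sym (trans (∑-cong (suc n) (λ i → distribˡ (p (toℕ i)) (g (suc (toℕ i))) (g (toℕ i)))) (∑-- (suc n) _ _)) ⟩
    moment n j (Δ g) ∎
    where
    open ≡-Reasoning
    p = powXm1 j
    A = ∑ n (λ i → p (toℕ i) * g (suc (toℕ i)))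
    B = ∑ n (λ i → p (suc (toℕ i)) * g (suc (toℕ i)))

    distribʳ : ∀ x y z → (x - y) * z ≡ x * z - y * z
    distribʳ = solve-∀

    distribˡ : ∀ x y z → x * (y - z) ≡ x * y - x * z
    distribˡ = solve-∀

    rearrange : ∀ p g a b c → - p * g + (a - b) ≡ (a + + 0 * c) - (p * g + b)
    rearrange = solve-∀

  -- Polynomial functions of degree less than j, described by the vanishing of the j-th difference,
  -- which is the form in which `moment-suc` produces it.
  data Degree< : ℕ → (ℕ → ℤ) → Set where
    vanishing  : ∀ {g} → (∀ i → g i ≡ + 0) → Degree< zero g
    differences : ∀ {j g} → Degree< j (Δ g) → Degree< (suc j) g

  degree-cong : ∀ {j g h} → (∀ i → g i ≡ h i) → Degree< j g → Degree< j h
  degree-cong g≗h (vanishing g≗0) = vanishing (λ i → trans (sym (g≗h i)) (g≗0 i))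
  degree-cong g≗h (differences dg) = differences (degree-cong (λ i → cong₂ _-_ (g≗h (suc i)) (g≗h i)) dg)

  degree-suc : ∀ {j g} → Degree< j g → Degree< (suc j) g
  degree-suc (vanishing g≗0) = differences (vanishing (λ i → cong₂ _-_ (g≗0 (suc i)) (g≗0 i)))
  degree-suc (differences dg) = differences (degree-suc dg)

  degree-mono : ∀ {j k g} → j ℕ.≤′ k → Degree< j g → Degree< k g
  degree-mono (ℕ.≤′-reflexive refl) dg = dg
  degree-mono (ℕ.≤′-step j≤k)       dg = degree-suc (degree-mono j≤k dg)

  degree-+ : ∀ {j g h} → Degree< j g → Degree< j h → Degree< j (λ i → g i + h i)
  degree-+ (vanishing g≗0) (vanishing h≗0) = vanishing (λ i → cong₂ _+_ (g≗0 i) (h≗0 i))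
  degree-+ {g = g} {h} (differences dg) (differences dh) =
    differences (degree-cong (λ i → Δ-+ (g (suc i)) (g i) (h (suc i)) (h i)) (degree-+ dg dh))
    where
    Δ-+ : ∀ a b c d → (a - b) + (c - d) ≡ (a + c) - (b + d)
    Δ-+ = solve-∀

  degree-shift : ∀ {j g} → Degree< j g → Degree< j (λ i → g (suc i))
  degree-shift (vanishing g≗0) = vanishing (λ i → g≗0 (suc i))
  degree-shift {g = g} (differences dg) = differences (degree-shift {g = Δ g} dg)

  -- By the discrete Leibniz rule, Δ (i g) is i Δ g plus the shift of g.
  degree-*id : ∀ {j g} → Degree< j g → Degree< (suc j) (λ i → + i * g i)
  degree-*id {g = g} (vanishing g≗0) = differences (vanishing (λ i → cong₂ _-_ (0≗ (suc i)) (0≗ i)))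
    where
    0≗ : ∀ i → + i * g i ≡ + 0
    0≗ i = trans (cong (λ z → + i * z) (g≗0 i)) (*-zeroʳ (+ i))
  degree-*id {g = g} (differences dg) = differences (degree-cong (λ i → leibniz (+ i) (g (suc i)) (g i))
    (degree-+ (degree-*id dg) (degree-shift {g = g} (differences dg))))
    where
    leibniz : ∀ i a b → i * (a - b) + a ≡ (+ 1 + i) * a - i * b
    leibniz = solve-∀

  degree-^ : ∀ k → Degree< (suc k) (λ i → (+ i) ^ k)
  degree-^ zero    = differences (vanishing (λ i → refl))
  degree-^ (suc k) = degree-*id (degree-^ k)

  -- Summation by parts, applied j times, leaves the j-th difference of g, which is 0.
  moment-vanish : ∀ {n} j {g} → j ℕ.≤ n → Degree< j g → moment n j g ≡ + 0
  moment-vanish {n} zero {g} _ (vanishing g≗0) =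
    ∑-0 (suc n) (λ i → trans (cong (λ z → powXm1 0 (toℕ i) * z) (g≗0 (toℕ i))) (*-zeroʳ (powXm1 0 (toℕ i))))
  moment-vanish (suc j) {g} j<n (differences dg) = trans (moment-suc g j<n) (moment-vanish j (ℕ.<⇒≤ j<n) dg)

  ∣-∑ : ∀ {k} d {f : Fin d → ℤ} → (∀ i → k ∣ f i) → k ∣ ∑ d f
  ∣-∑ {k} zero    {f} k∣f = ∣-by (sym (∑-zero f)) (∣0 k)
  ∣-∑ {k} (suc d) {f} k∣f = ∣-by (sym (∑-suc d f)) (∣m∣n⇒∣m+n (k∣f zero) (∣-∑ d (λ i → k∣f (suc i))))

  member-pairing : ∀ n m l (v : Vecℤ (suc n)) ((c , _) : v ∈A[ n , m , l ]) (g : ℕ → ℤ) →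
    ∑ (suc n) (λ i → v i * g (toℕ i)) ≡
    ∑ n (λ j → c j * (scale m l (toℕ j) * moment n (suc (toℕ j)) g))
  member-pairing n m l v (c , v≗) g = begin
    ∑ (suc n) (λ i → v i * g (toℕ i))
      ≡⟨ ∑-cong (suc n) (λ i → trans (cong (λ z → z * g (toℕ i)) (trans (v≗ i) (sym (∑-sumFin n _))))
           (sym (∑-*ʳ n (g (toℕ i)) _))) ⟩
    ∑ (suc n) (λ i → ∑ n (λ j → c j * (s j * p j i) * g (toℕ i)))
      ≡⟨ ∑-swap (suc n) n _ ⟩
    ∑ n (λ j → ∑ (suc n) (λ i → c j * (s j * p j i) * g (toℕ i)))
      ≡⟨ ∑-cong n (λ j → trans (∑-cong (suc n) (λ i → assoc (c j) (s j) (p j i) (g (toℕ i))))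
           (trans (∑-*ˡ (suc n) (c j) _) (cong (λ z → c j * z) (∑-*ˡ (suc n) (s j) _)))) ⟩
    ∑ n (λ j → c j * (s j * moment n (suc (toℕ j)) g)) ∎
    where
    open ≡-Reasoning
    s : Fin n → ℤ
    s j = scale m l (toℕ j)

    p : Fin n → Fin (suc n) → ℤ
    p j i = powXm1 (suc (toℕ j)) (toℕ i)

    assoc : ∀ c s p g → c * (s * p) * g ≡ c * (s * (p * g))
    assoc = solve-∀

  -- Every generator contains a positive power of x - 1, and the first difference of a constant is
  -- 0. The factor `+ 1` keeps the sum an instance of `member-pairing`.
  member-sum : ∀ n m l (v : Vecℤ (suc n)) → v ∈A[ n , m , l ] → ∑ (suc n) (λ i → v i * + 1) ≡ + 0
  member-sum n m l v v∈A@(c , _) = trans (member-pairing n m l v v∈A (λ _ → + 1)) (∑-0 n (λ j → trans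
    (cong (λ z → c j * (scale m l (toℕ j) * z))
      (moment-vanish (suc (toℕ j)) {λ _ → + 1} (Fin.toℕ<n j) (degree-mono (ℕ.≤⇒≤′ (s≤s z≤n)) (degree-^ 0))))
    (trans (cong (λ z → c j * z) (*-zeroʳ (scale m l (toℕ j)))) (*-zeroʳ (c j)))))

  -- Generators with exponent below m carry the factor l. For the others the exponent exceeds k, the
  -- degree of iᵏ, so that the moment is 0.
  member-powers : ∀ n m l (v : Vecℤ (suc n)) → v ∈A[ n , m , l ] → ∀ k → k ℕ.< m →
    + l ∣ ∑ (suc n) (λ i → v i * (+ toℕ i) ^ k)
  member-powers n m l v v∈A@(c , _) k k<m =
    ∣-by (sym (member-pairing n m l v v∈A (λ i → (+ i) ^ k))) (∣-∑ n (λ j → ∣n⇒∣m*n (c j) (divisible j)))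
    where
    divisible : ∀ j → + l ∣ scale m l (toℕ j) * moment n (suc (toℕ j)) (λ i → (+ i) ^ k)
    divisible j with suc (toℕ j) <ᵇ m in eq
    ... | true  = ∣m⇒∣m*n (moment n (suc (toℕ j)) (λ i → (+ i) ^ k)) ∣-refl
    ... | false = ∣-by (sym (trans (*-identityˡ _)
      (moment-vanish (suc (toℕ j)) {λ i → (+ i) ^ k} (Fin.toℕ<n j)
        (degree-mono (ℕ.≤⇒≤′ (ℕ.≤-trans k<m m≤1+j)) (degree-^ k))))) (∣0 (+ l))
      where
      m≤1+j : m ℕ.≤ suc (toℕ j)
      m≤1+j = ℕ.≮⇒≥ (λ 1+j<m → subst T eq (ℕ.<⇒<ᵇ 1+j<m))

  -- Multisets of indices and the positive and negative parts of a vector.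

  listSum : ∀ {A : Set} → (A → ℤ) → List A → ℤ
  listSum g []       = + 0
  listSum g (x ∷ xs) = g x + listSum g xs

  listSum-++ : ∀ {A : Set} (g : A → ℤ) xs ys → listSum g (xs ++ ys) ≡ listSum g xs + listSum g ys
  listSum-++ g []       ys = sym (+-identityˡ _)
  listSum-++ g (x ∷ xs) ys = trans (cong (λ z → g x + z) (listSum-++ g xs ys)) (sym (+-assoc (g x) _ _))

  listSum-map : ∀ {A B : Set} (g : B → ℤ) (f : A → B) xs → listSum g (map f xs) ≡ listSum (λ x → g (f x)) xs
  listSum-map g f []       = refl
  listSum-map g f (x ∷ xs) = cong (λ z → g (f x) + z) (listSum-map g f xs)

  listSum-replicate : ∀ {A : Set} (g : A → ℤ) k x → listSum g (replicate k x) ≡ + k * g x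
  listSum-replicate g zero    x = refl
  listSum-replicate g (suc k) x = trans (cong (λ z → g x + z) (listSum-replicate g k x)) (sym (suc-* (+ k) (g x)))

  listSum-1 : ∀ {A : Set} (xs : List A) → listSum (λ _ → + 1) xs ≡ + length xs
  listSum-1 []       = refl
  listSum-1 (x ∷ xs) = cong (λ z → + 1 + z) (listSum-1 xs)

  powerSum-map : ∀ {A : Set} (f : A → ℤ) xs k → powerSum (map f xs) k ≡ listSum (λ x → f x ^ k) xs
  powerSum-map f []       k = refl
  powerSum-map f (x ∷ xs) k = cong (λ z → f x ^ k + z) (powerSum-map f xs k)

  multiset : ∀ d → (Fin d → ℕ) → List (Fin d)
  multiset zero    μ = []
  multiset (suc d) μ = replicate (μ zero) zero ++ map suc (multiset d (λ i → μ (suc i)))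

  listSum-multiset : ∀ d μ (g : Fin d → ℤ) → listSum g (multiset d μ) ≡ ∑ d (λ i → + μ i * g i)
  listSum-multiset zero    μ g = sym (∑-zero _)
  listSum-multiset (suc d) μ g = trans (listSum-++ g (replicate (μ zero) zero) _) (trans
    (cong₂ _+_ (listSum-replicate g (μ zero) zero)
      (trans (listSum-map g suc (multiset d (λ i → μ (suc i)))) (listSum-multiset d (λ i → μ (suc i)) (λ i → g (suc i)))))
    (sym (∑-suc d _)))

  multiset-support : ∀ d μ → All (λ i → μ i ≢ 0) (multiset d μ)
  multiset-support zero    μ = []
  multiset-support (suc d) μ = All.++⁺ (copies (μ zero) refl) (All.map⁺ (multiset-support d (λ i → μ (suc i))))
    where
    copies : ∀ k → μ zero ≡ k → All (λ i → μ i ≢ 0) (replicate k zero)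
    copies zero    _  = []
    copies (suc k) eq = All.replicate⁺ (suc k) (λ eq′ → ℕ.1+n≢0 (trans (sym eq) eq′))

  multiset-empty : ∀ d μ → length (multiset d μ) ≡ 0 → ∀ i → μ i ≡ 0
  multiset-empty (suc d) μ len i with μ zero in eq
  multiset-empty (suc d) μ len zero    | zero = eq
  multiset-empty (suc d) μ len (suc i) | zero =
    multiset-empty d (λ i → μ (suc i)) (trans (sym (length-map suc (multiset d (λ i → μ (suc i))))) len) i

  posPart negPart : ℤ → ℕ
  posPart (+ k)      = k
  posPart (-[1+ k ]) = 0
  negPart (+ k)      = 0
  negPart (-[1+ k ]) = suc k

  pos-neg : ∀ x → x ≡ + posPart x - + negPart x
  pos-neg (+ k)      = sym (+-identityʳ (+ k))
  pos-neg (-[1+ k ]) = refl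

  -- The left side is |x|, and |x| ≤ x² for integers; summed over the entries this bounds the sizes
  -- of the multisets by the norm.
  pos+neg≤square : ∀ x → + posPart x + + negPart x ℤ.≤ x * x
  pos+neg≤square (+ zero)   = ℤ.+≤+ z≤n
  pos+neg≤square (+ suc k)  = ℤ.+≤+ (ℕ.≤-trans (ℕ.≤-reflexive (ℕ.+-identityʳ (suc k))) (ℕ.m≤m*n (suc k) (suc k)))
  pos+neg≤square (-[1+ k ]) = ℤ.+≤+ (ℕ.m≤m*n (suc k) (suc k))

  pos∧neg≡0 : ∀ x → posPart x ≢ 0 → negPart x ≢ 0 → ⊥
  pos∧neg≡0 (+ k)      _   neg = neg refl
  pos∧neg≡0 (-[1+ k ]) pos _   = pos refl

  ∑-mono : ∀ d {f g : Fin d → ℤ} → (∀ i → f i ℤ.≤ g i) → ∑ d f ℤ.≤ ∑ d g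
  ∑-mono zero    f≤g = ≤-reflexive (trans (∑-zero _) (sym (∑-zero _)))
  ∑-mono (suc d) {f} {g} f≤g = ≤-trans (≤-reflexive (∑-suc d f))
    (≤-trans (+-mono-≤ (f≤g zero) (∑-mono d (λ i → f≤g (suc i)))) (≤-reflexive (sym (∑-suc d g))))

  module Split {d : ℕ} (v : Vecℤ d) where

    positives negatives : List (Fin d)
    positives = multiset d (λ i → posPart (v i))
    negatives = multiset d (λ i → negPart (v i))

    pairing : ∀ g → ∑ d (λ i → v i * g i) ≡ listSum g positives - listSum g negatives
    pairing g = begin
      ∑ d (λ i → v i * g i)
        ≡⟨ ∑-cong d (λ i → trans (cong (λ z → z * g i) (pos-neg (v i)))
             (distrib (+ posPart (v i)) (+ negPart (v i)) (g i))) ⟩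
      ∑ d (λ i → + posPart (v i) * g i - + negPart (v i) * g i)
        ≡⟨ ∑-- d _ _ ⟩
      ∑ d (λ i → + posPart (v i) * g i) - ∑ d (λ i → + negPart (v i) * g i)
        ≡⟨ sym (cong₂ _-_ (listSum-multiset d _ g) (listSum-multiset d _ g)) ⟩
      listSum g positives - listSum g negatives ∎
      where
      open ≡-Reasoning
      distrib : ∀ x y z → (x - y) * z ≡ x * z - y * z
      distrib = solve-∀

    length≤normSq : + (length positives ℕ.+ length negatives) ℤ.≤ normSq v
    length≤normSq = begin
      + length positives + + length negatives
        ≡⟨ cong₂ _+_ (size (λ i → posPart (v i))) (size (λ i → negPart (v i))) ⟩
      ∑ d (λ i → + posPart (v i)) + ∑ d (λ i → + negPart (v i))
        ≡⟨ sym (∑-+ d _ _) ⟩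
      ∑ d (λ i → + posPart (v i) + + negPart (v i))
        ≤⟨ ∑-mono d (λ i → pos+neg≤square (v i)) ⟩
      ∑ d (λ i → v i * v i)
        ≡⟨ ∑-sumFin d _ ⟩
      normSq v ∎
      where
      open ≤-Reasoning
      size : ∀ μ → + length (multiset d μ) ≡ ∑ d (λ i → + μ i)
      size μ = trans (sym (listSum-1 (multiset d μ))) (trans (listSum-multiset d μ _)
        (∑-cong d (λ i → *-identityʳ (+ μ i))))

  ∣∧<⇒≡0 : ∀ {l k} → l ℕ.∣ k → k ℕ.< l → k ≡ 0
  ∣∧<⇒≡0 {k = zero}  _   _   = refl
  ∣∧<⇒≡0 {k = suc k} l∣k k<l = ⊥-elim (ℕ.<⇒≱ k<l (ℕ.∣⇒≤ l∣k))

  -- As |a - b| ≤ max(a, b) < l, divisibility by l forces a - b = 0.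
  residue-unique : ∀ {l a b} → a ℕ.< l → b ℕ.< l → + l ∣ - (+ b) + + a → a ≡ b
  residue-unique {l} {a} {b} a<l b<l l∣ = +-injective (i-j≡0⇒i≡j (+ a) (+ b) (∣i∣≡0⇒i≡0
    (∣∧<⇒≡0 (∣⇒∣ᵤ (∣-by (+-comm (- (+ b)) (+ a)) l∣)) (ℕ.≤-<-trans
      (ℕ.≤-trans (ℕ.≤-reflexive (cong abs (m-n≡m⊖n a b))) (∣m⊝n∣≤m⊔n a b)) (ℕ.⊔-lub a<l b<l)))))

  module MinimumNorm (n m l : ℕ) (2m<n : 2 ℕ.* m ℕ.< n) (n<l : suc n ℕ.≤ l) (l-prime : Prime l)
    (v : Vecℤ (suc n)) (v∈A : v ∈A[ n , m , l ]) where

    open Split v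

    index : Fin (suc n) → ℤ
    index i = + toℕ i

    sizes : length positives ≡ length negatives
    sizes = +-injective (i-j≡0⇒i≡j _ _ (trans
      (cong₂ _-_ (sym (listSum-1 positives)) (sym (listSum-1 negatives)))
      (trans (sym (pairing (λ _ → + 1))) (member-sum n m l v v∈A))))

    powerSums : ∀ k → k ℕ.< m → + l ∣ powerSum (map index positives) k - powerSum (map index negatives) k
    powerSums k k<m = ∣-by
      (trans (pairing (λ i → index i ^ k))
        (sym (cong₂ _-_ (powerSum-map index positives k) (powerSum-map index negatives k))))
      (member-powers n m l v v∈A k k<m)

    common : length positives ℕ.< m → ∀ {j} → j ∈ negatives → ∃ λ x → x ∈ map index positives × + l ∣ - index j + x
    common N<m j∈negatives = common-residue l-prime (map index positives) (map index negatives)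
      (trans (length-map index positives) (trans sizes (sym (length-map index negatives))))
      (ℕ.<-≤-trans N′<m m≤l) (λ k _ k≤N → powerSums k (ℕ.≤-<-trans k≤N N′<m)) (∈-map⁺ index j∈negatives)
      where
      N′<m = ℕ.≤-<-trans (ℕ.≤-reflexive (length-map index positives)) N<m
      m≤l  = ℕ.≤-trans (ℕ.m≤m+n m _) (ℕ.≤-trans (ℕ.<⇒≤ 2m<n) (ℕ.≤-trans (ℕ.n≤1+n n) n<l))

    disjoint : length positives ℕ.< m → ∀ {j} → j ∈ negatives → ⊥
    disjoint N<m {j} j∈negatives
      with x , x∈ , l∣x-j ← common N<m j∈negatives
      with i , i∈positives , refl ← ∈-map⁻ index x∈
      -- Indices are at most n < l, so congruent ones coincide; then vᵢ would have both a positive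
      -- and a negative part.
      with refl ← Fin.toℕ-injective {i = i} {j}
             (residue-unique (ℕ.<-≤-trans (Fin.toℕ<n i) n<l) (ℕ.<-≤-trans (Fin.toℕ<n j) n<l) l∣x-j) =
      pos∧neg≡0 (v i) (All.lookup (multiset-support (suc n) (λ i → posPart (v i))) i∈positives)
        (All.lookup (multiset-support (suc n) (λ i → negPart (v i))) j∈negatives)

    -- Without negative entries there are no positive ones either, since the two multisets have
    -- equal size; then v would be 0.
    nonempty : (∃ λ i → v i ≢ + 0) → ∃ λ j → j ∈ negatives
    nonempty (i , vᵢ≢0) = head negatives refl
      where
      head : ∀ js → js ≡ negatives → ∃ λ j → j ∈ js
      head (j ∷ js) _  = j , here refl
      head []       eq = ⊥-elim (vᵢ≢0 (trans (pos-neg (v i)) (cong₂ (λ a b → + a - + b)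
        (multiset-empty (suc n) (λ i → posPart (v i)) (trans sizes (cong length (sym eq))) i)
        (multiset-empty (suc n) (λ i → negPart (v i)) (cong length (sym eq)) i))))

    minimum-norm : (∃ λ i → v i ≢ + 0) → + (2 ℕ.* m) ℤ.≤ normSq v
    -- `2 * m` unfolds to `m + (m + 0)`: one m bounds the positives, the other the negatives.
    minimum-norm v≢0 = ≤-trans (ℤ.+≤+ (ℕ.+-mono-≤ m≤N (ℕ.≤-trans (ℕ.≤-reflexive (ℕ.+-identityʳ m))
      (ℕ.≤-trans m≤N (ℕ.≤-reflexive sizes))))) length≤normSq
      where
      m≤N : m ℕ.≤ length positives
      m≤N = ℕ.≮⇒≥ (λ N<m → disjoint N<m (proj₂ (nonempty v≢0)))

-- Craig lattices: binomial coefficients at a prime.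

module CraigLattices where

  open import Data.Integer.Base using (_*_)
  open import Data.Nat.Combinatorics using (_C_; nCn≡1; nC1≡n; k>n⇒nCk≡0; nCk+nC[k+1]≡[n+1]C[k+1])
  open Sums
  open GramMatrices

  absorption : ∀ n k → suc k ℕ.* (suc n C suc k) ≡ suc n ℕ.* (n C k)
  absorption n       zero    = trans (ℕ.*-identityˡ _) (trans (nC1≡n (suc n)) (sym (ℕ.*-identityʳ (suc n))))
  absorption zero    (suc k) = trans
    (cong (λ z → suc (suc k) ℕ.* z) (k>n⇒nCk≡0 {1} {suc (suc k)} (s≤s (s≤s z≤n)))) (ℕ.*-zeroʳ (suc (suc k)))
  absorption (suc n) (suc k) = begin
    suc (suc k) ℕ.* (suc (suc n) C suc (suc k))
      ≡⟨ cong (λ z → suc (suc k) ℕ.* z) (sym (nCk+nC[k+1]≡[n+1]C[k+1] (suc n) (suc k))) ⟩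
    suc (suc k) ℕ.* (a ℕ.+ b)
      ≡⟨ split (suc k) a b ⟩
    suc k ℕ.* a ℕ.+ a ℕ.+ suc (suc k) ℕ.* b
      ≡⟨ cong₂ (λ y z → y ℕ.+ a ℕ.+ z) (absorption n k) (absorption n (suc k)) ⟩
    suc n ℕ.* (n C k) ℕ.+ a ℕ.+ suc n ℕ.* (n C suc k)
      ≡⟨ collect (suc n) (n C k) a (n C suc k) ⟩
    a ℕ.+ suc n ℕ.* ((n C k) ℕ.+ (n C suc k))
      ≡⟨ cong (λ z → a ℕ.+ suc n ℕ.* z) (nCk+nC[k+1]≡[n+1]C[k+1] n k) ⟩
    suc (suc n) ℕ.* a ∎
    where
    open ≡-Reasoning
    a = suc n C suc k
    b = suc n C suc (suc k)

    split : ∀ k a b → (1 ℕ.+ k) ℕ.* (a ℕ.+ b) ≡ k ℕ.* a ℕ.+ a ℕ.+ (1 ℕ.+ k) ℕ.* b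
    split = ℕ-Solver.solve-∀

    collect : ∀ n x a y → n ℕ.* x ℕ.+ a ℕ.+ n ℕ.* y ≡ a ℕ.+ n ℕ.* (x ℕ.+ y)
    collect = ℕ-Solver.solve-∀

  -- By `absorption` the prime n + 1 divides k + 1 times the binomial coefficient, and it does not
  -- divide k + 1 ≤ n.
  prime∣binomial : ∀ {n k} → Prime (suc n) → k ℕ.< n → suc n ℕ.∣ suc n C suc k
  prime∣binomial {n} {k} n-prime k<n = Sum.[ (λ n∣k → ⊥-elim (ℕ.<⇒≱ (s≤s k<n) (ℕ.∣⇒≤ n∣k))) , id ]′
    (euclidsLemma (suc k) (suc n C suc k) n-prime
      (subst (suc n ℕ.∣_) (sym (absorption n k)) (ℕ.m∣m*n (n C k))))

  -- Arithmetic and ideals in ℤ[x]/(xⁿ⁺¹ - 1).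

  module Cyclic (n : ℕ) where

    V : Set
    V = Vecℤ (suc n)

    -- The cyclic predecessor, which makes `shift` multiplication by x.
    prev : Fin (suc n) → Fin (suc n)
    prev zero    = fromℕ n
    prev (suc i) = inject₁ i

    shift : V → V
    shift v i = v (prev i)

    shift^ : ℕ → V → V
    shift^ zero    v = v
    shift^ (suc k) v = shift (shift^ k v)

    -- Multiplication by x − 1 modulo xⁿ⁺¹ − 1.
    Y : V → V
    Y v i = v (prev i) - v i

    Y^ : ℕ → V → V
    Y^ zero    v = v
    Y^ (suc k) v = Y (Y^ k v)

    Y-cong : ∀ {v w} → v ≗ w → Y v ≗ Y w
    Y-cong v≗w i = cong₂ _-_ (v≗w (prev i)) (v≗w i)

    Y-scale : ∀ c v → Y (λ i → c * v i) ≗ (λ i → c * Y v i)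
    Y-scale c v i = distrib c (v (prev i)) (v i)
      where
      distrib : ∀ c x y → c * x - c * y ≡ c * (x - y)
      distrib = solve-∀

    b : ℕ → V
    b = xm1^ n

    -- For k < n the coefficient of xⁿ in (x - 1)ᵏ is 0, so nothing wraps around.
    Y-b : ∀ {k} → k ℕ.< n → Y (b k) ≗ b (suc k)
    Y-b {k} k<n zero    = trans
      (cong (λ z → z - powXm1 k 0) (trans (cong (powXm1 k) (Fin.toℕ-fromℕ n)) (powXm1-above k<n))) (+-identityˡ _)
    Y-b {k} k<n (suc i) = cong (λ z → powXm1 k z - powXm1 k (suc (toℕ i))) (Fin.toℕ-inject₁ i)

    Y^-b : ∀ k j → j ℕ.+ k ℕ.≤ n → Y^ k (b j) ≗ b (j ℕ.+ k)
    Y^-b zero    j _     i = cong (λ z → b z i) (sym (ℕ.+-identityʳ j))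
    Y^-b (suc k) j j+k<n i = trans (Y-cong (Y^-b k j (ℕ.<⇒≤ j+k<n′)) i)
      (trans (Y-b j+k<n′ i) (cong (λ z → b z i) (sym (ℕ.+-suc j k))))
      where
      j+k<n′ : j ℕ.+ k ℕ.< n
      j+k<n′ = ℕ.≤-trans (ℕ.≤-reflexive (sym (ℕ.+-suc j k))) j+k<n

    -- Multiplication by xᵏ in the form that `cyc*` contains. Adding n + 1 first keeps the truncated
    -- subtraction exact for k ≤ n + 1.
    rotate : ℕ → V → V
    rotate k v i = v ((toℕ i ℕ.+ suc n ℕ.∸ k) mod suc n)

    mod-cong : ∀ a b → a % suc n ≡ b % suc n → a mod suc n ≡ b mod suc n
    mod-cong a b eq = Fin.toℕ-injective (trans (Fin.toℕ-fromℕ< (m%n<n a (suc n)))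
      (trans eq (sym (Fin.toℕ-fromℕ< (m%n<n b (suc n))))))

    mod-toℕ : ∀ (i : Fin (suc n)) → toℕ i mod suc n ≡ i
    mod-toℕ i = Fin.toℕ-injective (trans (Fin.toℕ-fromℕ< (m%n<n (toℕ i) (suc n))) (m<n⇒m%n≡m (Fin.toℕ<n i)))

    rotate-0 : ∀ v → rotate 0 v ≗ v
    rotate-0 v i = cong v (trans (mod-cong (toℕ i ℕ.+ suc n) (toℕ i) ([m+n]%n≡m%n (toℕ i) (suc n))) (mod-toℕ i))

    rotate-full : ∀ v → rotate (suc n) v ≗ v
    rotate-full v i = cong v (trans (cong (_mod suc n) (ℕ.m+n∸n≡m (toℕ i) (suc n))) (mod-toℕ i))

    rotate-suc : ∀ {k} v → k ℕ.≤ n → shift (rotate k v) ≗ rotate (suc k) v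
    rotate-suc {k} v k≤n zero = cong v (trans
      (cong (_mod suc n) (trans (cong (λ z → z ℕ.+ suc n ℕ.∸ k) (Fin.toℕ-fromℕ n)) (ℕ.+-∸-comm (suc n) k≤n)))
      (mod-cong (n ℕ.∸ k ℕ.+ suc n) (n ℕ.∸ k) ([m+n]%n≡m%n (n ℕ.∸ k) (suc n))))
    rotate-suc {k} v k≤n (suc i) =
      cong (λ z → v ((z ℕ.+ suc n ℕ.∸ k) mod suc n)) (Fin.toℕ-inject₁ i)

    shift^-rotate : ∀ k v → k ℕ.≤ suc n → shift^ k v ≗ rotate k v
    shift^-rotate zero    v _         i = sym (rotate-0 v i)
    shift^-rotate (suc k) v (s≤s k≤n) i =
      trans (shift^-rotate k v (ℕ.m≤n⇒m≤1+n k≤n) (prev i)) (rotate-suc v k≤n i)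

    -- The binomial theorem for x = 1 + Y, by Pascal's rule.
    shift^-binomial : ∀ N v → shift^ N v ≗ (λ i → ∑ (suc N) (λ k → + (N C toℕ k) * Y^ (toℕ k) v i))
    shift^-binomial zero    v i = sym (trans (∑-suc 0 _) (trans
      (cong₂ _+_ (*-identityˡ (v i)) (∑-zero _)) (+-identityʳ (v i))))
    shift^-binomial (suc N) v i = begin
      shift^ N v (prev i)
        ≡⟨ shift^-binomial N v (prev i) ⟩
      ∑ (suc N) (λ k → + (N C toℕ k) * Y^ (toℕ k) v (prev i))
        ≡⟨ ∑-cong (suc N) (λ k → shift-Y (+ (N C toℕ k)) (Y^ (toℕ k) v (prev i)) (Y^ (toℕ k) v i)) ⟩
      ∑ (suc N) (λ k → + (N C toℕ k) * Y^ (toℕ k) v i + + (N C toℕ k) * Y^ (suc (toℕ k)) v i)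
        ≡⟨ ∑-+ (suc N) _ _ ⟩
      W + Z
        -- `N C suc N` is 0, so W can be extended by one term; without its first term it then lines
        -- up with Z.
        ≡⟨ cong (λ z → z + Z) (trans (sym (+-identityʳ W))
             (cong (λ z → W + + z * Y^ (suc N) v i)
               (sym (k>n⇒nCk≡0 {N} (ℕ.n<1+n N))))) ⟩
      W + + (N C suc N) * Y^ (suc N) v i + Z
        ≡⟨ cong (λ z → z + Z) (trans (sym (∑-snoc (suc N) (λ k → + (N C k) * Y^ k v i))) (∑-suc (suc N) _)) ⟩
      + (N C 0) * v i + ∑ (suc N) (λ k → + (N C suc (toℕ k)) * Y^ (suc (toℕ k)) v i) + Z
        ≡⟨ +-assoc (+ (N C 0) * v i) _ Z ⟩
      + (N C 0) * v i + (∑ (suc N) (λ k → + (N C suc (toℕ k)) * Y^ (suc (toℕ k)) v i) + Z)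
        ≡⟨ cong (λ z → + (N C 0) * v i + z) (trans (sym (∑-+ (suc N) _ _)) (∑-cong (suc N) pascal)) ⟩
      + (suc N C 0) * v i + ∑ (suc N) (λ k → + (suc N C suc (toℕ k)) * Y^ (suc (toℕ k)) v i)
        ≡⟨ sym (∑-suc (suc N) _) ⟩
      ∑ (suc (suc N)) (λ k → + (suc N C toℕ k) * Y^ (toℕ k) v i) ∎
      where
      open ≡-Reasoning
      W = ∑ (suc N) (λ k → + (N C toℕ k) * Y^ (toℕ k) v i)
      Z = ∑ (suc N) (λ k → + (N C toℕ k) * Y^ (suc (toℕ k)) v i)

      shift-Y : ∀ c x y → c * x ≡ c * y + c * (x - y)
      shift-Y = solve-∀

      pascal : ∀ (k : Fin (suc N)) →
        + (N C suc (toℕ k)) * Y^ (suc (toℕ k)) v i + + (N C toℕ k) * Y^ (suc (toℕ k)) v i ≡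
        + (suc N C suc (toℕ k)) * Y^ (suc (toℕ k)) v i
      pascal k = trans (sym (*-distribʳ-+ (Y^ (suc (toℕ k)) v i) (+ (N C suc (toℕ k))) (+ (N C toℕ k))))
        (cong (λ z → + z * Y^ (suc (toℕ k)) v i)
          (trans (ℕ.+-comm (N C suc (toℕ k)) (N C toℕ k)) (nCk+nC[k+1]≡[n+1]C[k+1] N (toℕ k))))

    -- (1 + Y)ⁿ⁺¹ = 1.
    Y^-relation : ∀ v i →
      ∑ n (λ k → + (suc n C suc (toℕ k)) * Y^ (suc (toℕ k)) v i) + Y^ (suc n) v i ≡ + 0
    Y^-relation v i = ∙-cancelˡ (AbelianGroup.group +-0-abelianGroup) (v i) _ _ (begin
      v i + (∑ n (λ k → + (suc n C suc (toℕ k)) * Y^ (suc (toℕ k)) v i) + Y^ (suc n) v i)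
        ≡⟨ cong₂ (λ y z → y + (∑ n (λ k → + (suc n C suc (toℕ k)) * Y^ (suc (toℕ k)) v i) + z))
             (sym (*-identityˡ (v i)))
             (trans (sym (*-identityˡ (Y^ (suc n) v i))) (cong (λ z → + z * Y^ (suc n) v i) (sym (nCn≡1 (suc n))))) ⟩
      + 1 * v i + (∑ n (λ k → + (suc n C suc (toℕ k)) * Y^ (suc (toℕ k)) v i) + + (suc n C suc n) * Y^ (suc n) v i)
        ≡⟨ cong (λ z → + 1 * v i + z) (sym (∑-snoc n (λ k → + (suc n C suc k) * Y^ (suc k) v i))) ⟩
      + (suc n C 0) * v i + ∑ (suc n) (λ k → + (suc n C suc (toℕ k)) * Y^ (suc (toℕ k)) v i)
        ≡⟨ sym (trans (shift^-binomial (suc n) v i) (∑-suc (suc n) _)) ⟩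
      shift^ (suc n) v i
        ≡⟨ trans (shift^-rotate (suc n) v ℕ.≤-refl i) (rotate-full v i) ⟩
      v i
        ≡⟨ sym (+-identityʳ (v i)) ⟩
      v i + + 0 ∎)
      where
      open ≡-Reasoning

    -- Closure under Y amounts to closure under x = 1 + Y. Membership must respect pointwise
    -- equality, as vectors are functions.
    record IsIdeal (I : V → Set) : Set where
      field
        ≗-mem   : ∀ {v w} → v ≗ w → I v → I w
        0-mem   : I (λ _ → + 0)
        +-mem   : ∀ {v w} → I v → I w → I (λ i → v i + w i)
        *-mem   : ∀ c {v} → I v → I (λ i → c * v i)
        Y-mem   : ∀ {v} → I v → I (Y v)

      ∑-mem : ∀ d {f : Fin d → V} → (∀ j → I (f j)) → I (λ i → ∑ d (λ j → f j i))
      ∑-mem zero    f∈I = ≗-mem (λ i → sym (∑-zero _)) 0-mem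
      ∑-mem (suc d) f∈I = ≗-mem (λ i → sym (∑-suc d _)) (+-mem (f∈I zero) (∑-mem d (λ j → f∈I (suc j))))

      shift^-mem : ∀ k {v} → I v → I (shift^ k v)
      shift^-mem zero    v∈I = v∈I
      shift^-mem (suc k) {v} v∈I = ≗-mem (λ i → cancel (shift^ k v (prev i)) (shift^ k v i))
        (+-mem (Y-mem (shift^-mem k v∈I)) (shift^-mem k v∈I))
        where
        cancel : ∀ x y → x - y + y ≡ x
        cancel = solve-∀

      Y^-mem : ∀ k {v} → I v → I (Y^ k v)
      Y^-mem zero    v∈I = v∈I
      Y^-mem (suc k) v∈I = Y-mem (Y^-mem k v∈I)

    module _ {I : V → Set} (ideal : IsIdeal I) where
      open IsIdeal ideal

      -- The first m - j factors lead from (x - 1)ʲ to (x - 1)ᵐ without wrapping, and the others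
      -- stay in the ideal. Since j + k may exceed n, `Y^-b` does not cover all of them.
      Y^-b-mem : ∀ {m} → m ℕ.≤ n → I (b m) → ∀ k j → j ℕ.≤ m → m ℕ.≤ j ℕ.+ k → I (Y^ k (b j))
      Y^-b-mem {m} m≤n b∈I k j j≤m m≤j+k = subst (λ k → I (Y^ k (b j))) (ℕ.m∸n+n≡m m∸j≤k)
        (resp-Y^ (k ℕ.∸ (m ℕ.∸ j)) (Y^-mem (k ℕ.∸ (m ℕ.∸ j))
          (≗-mem (λ i → sym (trans (Y^-b (m ℕ.∸ j) j j+[m-j]≤n i) (cong (λ z → b z i) (ℕ.m+[n∸m]≡n j≤m)))) b∈I)))
        where
        m∸j≤k : m ℕ.∸ j ℕ.≤ k
        m∸j≤k = ℕ.m≤n+o⇒m∸n≤o m j m≤j+k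

        j+[m-j]≤n : j ℕ.+ (m ℕ.∸ j) ℕ.≤ n
        j+[m-j]≤n = ℕ.≤-trans (ℕ.≤-reflexive (ℕ.m+[n∸m]≡n j≤m)) m≤n

        resp-Y^ : ∀ k {h v} → I (Y^ k (Y^ h v)) → I (Y^ (k ℕ.+ h) v)
        resp-Y^ k {h} {v} = subst I (Y^-+ k)
          where
          Y^-+ : ∀ k → Y^ k (Y^ h v) ≡ Y^ (k ℕ.+ h) v
          Y^-+ zero    = refl
          Y^-+ (suc k) = cong Y (Y^-+ k)

      Y^-multiple-mem : ∀ c v k → I (λ i → c * Y^ 2 v i) → I (λ i → c * Y^ (suc (suc k)) v i)
      Y^-multiple-mem c v zero    cY²v∈I = cY²v∈I
      Y^-multiple-mem c v (suc k) cY²v∈I =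
        ≗-mem (Y-scale c (Y^ (suc (suc k)) v)) (Y-mem (Y^-multiple-mem c v k cY²v∈I))

      first-mem : ∀ d (f : ℕ → V) → 0 ℕ.< d → I (λ i → ∑ d (λ k → f (toℕ k) i)) →
        (∀ k → suc k ℕ.< d → I (f (suc k))) → I (f 0)
      first-mem (suc d) f _ sum∈I rest∈I =
        ≗-mem (λ i → trans (cong (λ z → z + - (+ 1) * ∑ d (λ k → f (suc (toℕ k)) i)) (∑-suc d _)) (cancel (f 0 i) _))
          (+-mem sum∈I (*-mem (- (+ 1)) (∑-mem d (λ k → rest∈I (toℕ k) (s≤s (Fin.toℕ<n k))))))
        where
        cancel : ∀ x y → x + y + - (+ 1) * y ≡ x
        cancel = solve-∀

      -- As n + 1 divides the inner binomial coefficients, (1 + Y)ⁿ⁺¹ = 1 expresses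
      -- (n + 1) Y through (n + 1) Y² , … , (n + 1) Yⁿ and Yⁿ⁺¹.
      descent : 0 ℕ.< n → Prime (suc n) → ∀ v →
        I (λ i → + suc n * Y^ 2 v i) → I (Y^ (suc n) v) → I (λ i → + suc n * Y v i)
      descent 0<n N-prime v NY²v∈I Yᴺv∈I = ≗-mem (λ i → cong (λ z → + z * Y v i) (nC1≡n (suc n)))
        (first-mem n (λ k i → + (suc n C suc k) * Y^ (suc k) v i) 0<n
          (≗-mem (λ i → negate _ _ (Y^-relation v i)) (*-mem (- (+ 1)) Yᴺv∈I))
          inner)
        where
        negate : ∀ x y → x + y ≡ + 0 → - (+ 1) * y ≡ x
        negate x y x+y≡0 = trans (lemma x y) (trans (cong (λ z → x - z) x+y≡0) (+-identityʳ x))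
          where
          lemma : ∀ x y → - (+ 1) * y ≡ x - (x + y)
          lemma = solve-∀

        inner : ∀ k → suc k ℕ.< n → I (λ i → + (suc n C suc (suc k)) * Y^ (suc (suc k)) v i)
        inner k k<n with ℕ.divides q eq ← prime∣binomial N-prime k<n =
          ≗-mem (λ i → trans (sym (*-assoc (+ q) (+ suc n) _))
              (cong (λ z → z * Y^ (suc (suc k)) v i) (trans (sym (pos-* q (suc n))) (cong +_ (sym eq)))))
            (*-mem (+ q) (Y^-multiple-mem (+ suc n) v k NY²v∈I))

      -- Downward induction on the exponent, with t its distance from m: `descent` at (x - 1)ʲ
      -- passes from exponent j + 2 to j + 1.
      multiple-mem : Prime (suc n) → ∀ {m} → m ℕ.< n → I (b m) →
        ∀ t j → suc j ℕ.+ t ≡ m → I (λ i → + suc n * b (suc j) i)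
      multiple-mem N-prime m<n b∈I zero    j refl =
        *-mem (+ suc n) (subst (λ k → I (b k)) (ℕ.+-identityʳ (suc j)) b∈I)
      multiple-mem N-prime {m} m<n b∈I (suc t) j j+t≡m =
        ≗-mem (λ i → cong (λ z → + suc n * z) (Y-b j<n i))
          (descent (ℕ.≤-<-trans z≤n m<n) N-prime (b j)
            (≗-mem (λ i → cong (λ z → + suc n * z) (sym (trans (Y^-b 2 j j+2≤n i) (cong (λ z → b z i) (ℕ.+-comm j 2)))))
              (multiple-mem N-prime m<n b∈I t (suc j) (trans (sym (ℕ.+-suc (suc j) t)) j+t≡m)))
            (Y^-b-mem m≤n b∈I (suc n) j (ℕ.≤-trans (ℕ.n≤1+n j) j<m) (ℕ.≤-trans (ℕ.m≤n⇒m≤1+n m≤n) (ℕ.m≤n+m (suc n) j))))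
        where
        m≤n = ℕ.<⇒≤ m<n

        j<m : j ℕ.< m
        j<m = ℕ.≤-trans (ℕ.m≤m+n (suc j) (suc t)) (ℕ.≤-reflexive j+t≡m)

        j<n = ℕ.<-trans j<m m<n

        j+2≤n : j ℕ.+ 2 ℕ.≤ n
        j+2≤n = ℕ.≤-trans (ℕ.≤-reflexive (ℕ.+-comm j 2)) (ℕ.≤-trans (s≤s j<m) m<n)

    -- Spans and the ideal generated by one element.

    unit : ∀ {d} → Fin d → Fin d → ℤ
    unit zero    zero    = + 1
    unit zero    (suc j) = + 0
    unit (suc i) zero    = + 0
    unit (suc i) (suc j) = unit i j

    ∑-unit : ∀ {d} (i : Fin d) (f : Fin d → ℤ) → ∑ d (λ j → unit i j * f j) ≡ f i
    ∑-unit {suc d} zero    f = trans (∑-suc d _) (trans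
      (cong₂ _+_ (*-identityˡ (f zero)) (∑-0 d (λ _ → refl))) (+-identityʳ (f zero)))
    ∑-unit {suc d} (suc i) f = trans (∑-suc d _) (trans (+-identityˡ _) (∑-unit i (λ j → f (suc j))))

    Span : ∀ {d} → (Fin d → V) → V → Set
    Span {d} e v = ∃ λ (c : Fin d → ℤ) → ∀ i → v i ≡ ∑ d (λ j → c j * e j i)

    module _ {d} (e : Fin d → V) where

      span-≗ : ∀ {v w} → v ≗ w → Span e v → Span e w
      span-≗ v≗w (c , v≗) = c , λ i → trans (sym (v≗w i)) (v≗ i)

      span-0 : Span e (λ _ → + 0)
      span-0 = (λ _ → + 0) , λ i → sym (∑-0 d (λ _ → refl))

      span-+ : ∀ {v w} → Span e v → Span e w → Span e (λ i → v i + w i)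
      span-+ (c , v≗) (c′ , w≗) = (λ j → c j + c′ j) , λ i → trans (cong₂ _+_ (v≗ i) (w≗ i))
        (trans (sym (∑-+ d _ _)) (∑-cong d (λ j → sym (*-distribʳ-+ (e j i) (c j) (c′ j)))))

      span-* : ∀ x {v} → Span e v → Span e (λ i → x * v i)
      span-* x (c , v≗) = (λ j → x * c j) , λ i → trans (cong (λ z → x * z) (v≗ i))
        (trans (sym (∑-*ˡ d x _)) (∑-cong d (λ j → sym (*-assoc x (c j) (e j i)))))

      span-gen : ∀ j → Span e (e j)
      span-gen j = unit j , λ i → sym (∑-unit j (λ k → e k i))

      span-∑ : ∀ d′ {f : Fin d′ → V} → (∀ j → Span e (f j)) → Span e (λ i → ∑ d′ (λ j → f j i))
      span-∑ zero     f∈ = span-≗ (λ i → sym (∑-zero _)) span-0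
      span-∑ (suc d′) f∈ = span-≗ (λ i → sym (∑-suc d′ _)) (span-+ (f∈ zero) (span-∑ d′ (λ j → f∈ (suc j))))

      span-ideal : (∀ j → Span e (Y (e j))) → IsIdeal (Span e)
      span-ideal Ye∈ = record
        { ≗-mem = span-≗
        ; 0-mem = span-0
        ; +-mem = span-+
        ; *-mem = span-*
        ; Y-mem = λ { {v} (c , v≗) → span-≗
            (λ i → sym (trans (cong₂ _-_ (v≗ (prev i)) (v≗ i)) (trans (sym (∑-- d _ _))
              (∑-cong d (λ j → distrib (c j) (e j (prev i)) (e j i))))))
            (span-∑ d (λ j → span-* (c j) (Ye∈ j))) }
        }
        where
        distrib : ∀ c x y → c * x - c * y ≡ c * (x - y)
        distrib = solve-∀

    span-⊆ : ∀ {d} {e : Fin d → V} {I} → IsIdeal I → (∀ j → I (e j)) → ∀ {v} → Span e v → I v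
    span-⊆ {d} ideal e∈I (c , v≗) = ≗-mem (λ i → sym (v≗ i)) (∑-mem d (λ j → *-mem (c j) (e∈I j)))
      where open IsIdeal ideal

    module _ (g : V) where

      -- The vectors xʲ g. Their span is the principal ideal of g: the coefficients form the first
      -- factor of `cyc*`.
      rotations : Fin (suc n) → V
      rotations j = rotate (toℕ j) g

      -- Y takes xʲ g to xʲ⁺¹ g - xʲ g, and for j = n the first term is g again.
      rotations-ideal : IsIdeal (Span rotations)
      rotations-ideal = span-ideal rotations λ j →
        span-≗ rotations (λ i → difference-≗ j i)
          (span-+ rotations (next j (ℕ.m≤n⇒m<n∨m≡n (Fin.toℕ≤pred[n] j))) (span-* rotations (- (+ 1)) (span-gen rotations j)))
        where
        difference-≗ : ∀ j i → rotate (suc (toℕ j)) g i + - (+ 1) * rotations j i ≡ Y (rotations j) i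
        difference-≗ j i = cong₂ _+_ (sym (rotate-suc g (Fin.toℕ≤pred[n] j) i)) (-1*i≡-i (rotations j i))

        next : ∀ j → toℕ j ℕ.< n ⊎ toℕ j ≡ n → Span rotations (rotate (suc (toℕ j)) g)
        next j (inj₁ j<n) = subst (λ k → Span rotations (rotate k g)) (Fin.toℕ-fromℕ< (s≤s j<n))
          (span-gen rotations (fromℕ< (s≤s j<n)))
        next j (inj₂ j≡n) = span-≗ rotations
          (λ i → trans (rotate-0 g i) (sym (trans (cong (λ k → rotate (suc k) g i) j≡n) (rotate-full g i))))
          (span-gen rotations zero)

      rotations-⊆ : ∀ {I} → IsIdeal I → I g → ∀ {v} → Span rotations v → I v
      rotations-⊆ ideal g∈I = span-⊆ ideal λ j →
        IsIdeal.≗-mem ideal (shift^-rotate (toℕ j) g (ℕ.<⇒≤ (Fin.toℕ<n j))) (IsIdeal.shift^-mem ideal (toℕ j) g∈I)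

      generator-mem : Span rotations g
      generator-mem = span-≗ rotations (rotate-0 g) (span-gen rotations zero)

  scale-∣ : ∀ m l k {x} → + l ∣ x → scale m l k ∣ x
  scale-∣ m l k {x} l∣x with suc k <ᵇ m
  ... | true  = l∣x
  ... | false = divides x (sym (*-identityʳ x))

  scale-high : ∀ {m} l {k} → m ℕ.≤ suc k → scale m l k ≡ + 1
  scale-high {m} l {k} m≤1+k with suc k <ᵇ m in eq
  ... | true  = ⊥-elim (ℕ.<⇒≱ (ℕ.<ᵇ⇒< (suc k) m (subst T (sym eq) tt)) m≤1+k)
  ... | false = refl

  scale-low : ∀ {m} l {k} → suc k ℕ.< m → scale m l k ≡ + l
  scale-low {m} l {k} 1+k<m with suc k <ᵇ m in eq
  ... | true  = refl
  ... | false = ⊥-elim (subst T eq (ℕ.<⇒<ᵇ 1+k<m))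

  -- The factors only drop from l to 1, so multiplying a generator below the top one by x - 1 gives
  -- a multiple of the next generator.
  scale-suc-∣ : ∀ m l k → scale m l (suc k) ∣ scale m l k
  scale-suc-∣ m l k with m ℕ.≤? suc (suc k)
  ... | yes m≤2+k = subst (_∣ scale m l k) (sym (scale-high l m≤2+k))
    (divides (scale m l k) (sym (*-identityʳ _)))
  ... | no  m≰2+k = ∣-reflexive (trans (scale-low l (ℕ.≰⇒> m≰2+k))
    (sym (scale-low l (ℕ.<-trans (ℕ.n<1+n (suc k)) (ℕ.≰⇒> m≰2+k)))))

  -- Comparison of the two lattices for l = n + 1.

  module Lattice (n m : ℕ) (0<m : 0 ℕ.< m) (m<n : m ℕ.< n) where
    open Cyclic n

    N = suc n

    member-span : ∀ {v} → v ∈A[ n , m , N ] → Span (gen n m N) v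
    member-span (c , v≗) = c , λ i → trans (v≗ i) (sym (∑-sumFin n _))

    span-member : ∀ {v} → Span (gen n m N) v → v ∈A[ n , m , N ]
    span-member (c , v≗) = c , λ i → trans (v≗ i) (∑-sumFin n _)

    craig-span : ∀ {v} → v ∈Craig[ n , m ] → Span (rotations (b m)) v
    craig-span (f , v≗) = f , λ i → trans (v≗ i) (sym (∑-sumFin (suc n) _))

    span-craig : ∀ {v} → Span (rotations (b m)) v → v ∈Craig[ n , m ]
    span-craig (f , v≗) = f , λ i → trans (v≗ i) (∑-sumFin (suc n) _)

    monomial : ∀ {x k} → k ℕ.< n → scale m N k ∣ x → Span (gen n m N) (λ i → x * b (suc k) i)
    monomial {x} {k} k<n (divides q x≡qs) = span-≗ (gen n m N)
      (λ i → trans (sym (*-assoc q (scale m N (toℕ j)) (powXm1 (suc (toℕ j)) (toℕ i))))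
        (cong₂ _*_ (trans (cong (λ z → q * scale m N z) j≡k) (sym x≡qs)) (cong (λ z → powXm1 (suc z) (toℕ i)) j≡k)))
      (span-* (gen n m N) q (span-gen (gen n m N) j))
      where
      j   = fromℕ< k<n
      j≡k = Fin.toℕ-fromℕ< k<n

    module _ (inner : ∀ {k} → k ℕ.< n → scale m N k ∣ + (N C suc k)) where

      -- The relation (1 + Y)ⁿ⁺¹ = 1, applied to the polynomial 1, writes (x - 1)ⁿ⁺¹ through lower
      -- powers with binomial coefficients, which are divisible by the required factors.
      Y-top : Span (gen n m N) (Y (b n))
      Y-top = span-≗ (gen n m N) (λ i → negate _ _ (trans
          (cong₂ _+_ (∑-cong n (λ k → cong (λ z → + (N C suc (toℕ k)) * z) (sym (Y^-b (suc (toℕ k)) 0 (Fin.toℕ<n k) i))))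
            (Y-cong (λ i → sym (Y^-b n 0 ℕ.≤-refl i)) i))
          (Y^-relation (b 0) i)))
        (span-* (gen n m N) (- (+ 1)) (span-∑ (gen n m N) n (λ k → monomial (Fin.toℕ<n k) (inner (Fin.toℕ<n k)))))
        where
        negate : ∀ x y → x + y ≡ + 0 → - (+ 1) * x ≡ y
        negate x y x+y≡0 = trans (lemma x y) (trans (cong (λ z → y - z) x+y≡0) (+-identityʳ y))
          where
          lemma : ∀ x y → - (+ 1) * x ≡ y - (x + y)
          lemma = solve-∀

      lattice-ideal : IsIdeal (Span (gen n m N))
      lattice-ideal = span-ideal (gen n m N) λ j → span-≗ (gen n m N)
        (λ i → sym (Y-scale (scale m N (toℕ j)) (b (suc (toℕ j))) i))
        (step j (ℕ.m≤n⇒m<n∨m≡n (Fin.toℕ<n j)))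
        where
        step : ∀ (j : Fin n) → suc (toℕ j) ℕ.< n ⊎ suc (toℕ j) ≡ n →
          Span (gen n m N) (λ i → scale m N (toℕ j) * Y (b (suc (toℕ j))) i)
        step j (inj₁ 1+j<n) = span-≗ (gen n m N)
          (λ i → cong (λ z → scale m N (toℕ j) * z) (sym (Y-b 1+j<n i)))
          (monomial 1+j<n (scale-suc-∣ m N (toℕ j)))
        step j (inj₂ 1+j≡n) = span-* (gen n m N) (scale m N (toℕ j))
          (subst (λ k → Span (gen n m N) (Y (b k))) (sym 1+j≡n) Y-top)

      generator∈lattice : Span (gen n m N) (b m)
      generator∈lattice = top m refl
        where
        top : ∀ k → k ≡ m → Span (gen n m N) (b k)
        top zero    0≡m   = ⊥-elim (ℕ.<⇒≢ 0<m 0≡m)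
        top (suc k) 1+k≡m = span-≗ (gen n m N) (λ i → *-identityˡ _)
          (monomial {+ 1} (ℕ.≤-trans (ℕ.≤-reflexive 1+k≡m) (ℕ.<⇒≤ m<n))
            (∣-reflexive (scale-high N (ℕ.≤-reflexive (sym 1+k≡m)))))

    module _ (low : ∀ k → suc k ℕ.< m → Span (rotations (b m)) (λ i → + N * b (suc k) i)) where

      -- From exponent m on, the generators are multiples of (x - 1)ᵐ; the lower ones carry the
      -- factor n + 1 and are covered by `low`.
      gen∈craig : ∀ j → Span (rotations (b m)) (gen n m N j)
      gen∈craig j with m ℕ.≤? suc (toℕ j)
      ... | no  m≰1+j = span-≗ (rotations (b m))
        (λ i → cong (λ z → z * b (suc (toℕ j)) i) (sym (scale-low N (ℕ.≰⇒> m≰1+j)))) (low (toℕ j) (ℕ.≰⇒> m≰1+j))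
      ... | yes m≤1+j = span-* (rotations (b m)) (scale m N (toℕ j))
        (span-≗ (rotations (b m))
          (λ i → trans (Y^-b (suc (toℕ j) ℕ.∸ m) m (ℕ.≤-trans (ℕ.≤-reflexive (ℕ.m+[n∸m]≡n m≤1+j)) (Fin.toℕ<n j)) i)
            (cong (λ z → b z i) (ℕ.m+[n∸m]≡n m≤1+j)))
          (IsIdeal.Y^-mem (rotations-ideal (b m)) (suc (toℕ j) ℕ.∸ m) (generator-mem (b m))))

    inner-binomials : Prime N ⊎ m ≡ 1 → ∀ {k} → k ℕ.< n → scale m N k ∣ + (N C suc k)
    inner-binomials (inj₁ N-prime) {k} k<n = scale-∣ m N k (∣ᵤ⇒∣ (prime∣binomial N-prime k<n))
    -- For m = 1 every generator has factor 1.
    inner-binomials (inj₂ refl) {k}    _   = divides (+ (N C suc k)) (sym (*-identityʳ _))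

    low-multiples : Prime N ⊎ m ≡ 1 → ∀ k → suc k ℕ.< m → Span (rotations (b m)) (λ i → + N * b (suc k) i)
    low-multiples (inj₁ N-prime) k 1+k<m = multiple-mem (rotations-ideal (b m)) N-prime m<n (generator-mem (b m))
      (m ℕ.∸ suc k) k (ℕ.m+[n∸m]≡n (ℕ.<⇒≤ 1+k<m))
    low-multiples (inj₂ refl) k (s≤s ())

    lattice⊆craig : Prime N ⊎ m ≡ 1 → ∀ {v} → v ∈A[ n , m , N ] → v ∈Craig[ n , m ]
    lattice⊆craig h v∈A = span-craig (span-⊆ (rotations-ideal (b m)) (gen∈craig (low-multiples h)) (member-span v∈A))

    craig⊆lattice : Prime N ⊎ m ≡ 1 → ∀ {v} → v ∈Craig[ n , m ] → v ∈A[ n , m , N ]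
    craig⊆lattice h v∈C = span-member (rotations-⊆ (b m) (lattice-ideal (inner-binomials h))
      (generator∈lattice (inner-binomials h)) (craig-span v∈C))

open import Data.Nat using (ℕ; suc; _∸_; _*_; _^_; _≤_; _<_)
open import Data.Integer using (ℤ; +_) renaming (_≤_ to _≤ℤ_)
open import Data.Fin using (Fin)
open import Data.Product using (_×_; ∃)
open import Data.Sum using (_⊎_)
open import Data.Nat.Primality using (Prime)
open import Relation.Binary.PropositionalEquality using (_≡_; _≢_)

theorem2p1 : (n m l : ℕ) → 0 < n → 0 < m → 0 < l → 2 * m < n → suc n ≤ l →
    -- (1) A_n^{(m,n+1)} = A_n^{(m)} when n+1 is prime or m = 1
    ((Prime (suc n) ⊎ m ≡ 1) →
      (v : Vecℤ (suc n)) →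
        ((v ∈A[ n , m , suc n ] → v ∈Craig[ n , m ]) × (v ∈Craig[ n , m ] → v ∈A[ n , m , suc n ])))
    ×
    -- (2a) rank n: the n generators are linearly independent
    ((c : Fin n → ℤ) → (∀ i → comb n m l c i ≡ + 0) → ∀ j → c j ≡ + 0)
    ×
    -- (2b) volume^2 = det Gram = l^{2(m-1)} (n+1)
    (det n (gram n m l) ≡ + (l ^ (m ∸ 1) * l ^ (m ∸ 1) * suc n))
    ×
    -- (2c) l prime ⇒ μ ≥ 2m
    (Prime l → (v : Vecℤ (suc n)) → v ∈A[ n , m , l ] → (∃ λ i → v i ≢ + 0) →
      + (2 * m) ≤ℤ normSq v)
-- Matching m as k + 1 lets `m ∸ 1` compute to k.
theorem2p1 n m@(suc k) l 0<n 0<m 0<l 2m<n n<l =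
  (λ h v → lattice⊆craig h , craig⊆lattice h) ,
  gen-independent n m l 0<l ,
  det-gram n k l (ℕ.<⇒≤ (ℕ.<-trans (ℕ.n<1+n k) m<n)) ,
  λ l-prime v v∈A → MinimumNorm.minimum-norm n m l 2m<n n<l l-prime v v∈A
  where
  m<n : m < n
  m<n = ℕ.≤-<-trans (ℕ.m≤m+n m _) 2m<n

  open GramMatrices
  open ShortVectors
  open CraigLattices.Lattice n m 0<m m<n
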